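{- Let $n\ge 3$ and let $G$ be an $n$-vertex graph with vertex set $\{u_1,\ldots,u_n\}$. Then $G$ is reconstructible if there exists a vertex-deleted subgraph, say $G-u_n$ (labeling the vertices so that the deleted vertex is $u_n$), satisfying either of the following two conditions: (i) $G-u_n\in\mathcal{H}_{n-1}^s$; (ii) $G-u_n\in\mathcal{H}_{n-1}^a$ but $Q_0b\notin\{0,1\}^{n-1}\setminus\{b\}$, where $Q_0=Q_0(G-u_n)$ and $b\in\{0,1\}^{n-1}$ is the indicator vector (indexed by $u_1,\ldots,u_{n-1}$) of the neighborhood of $u_n$ in $G$.
   Context: Graphs are finite, simple and undirected. The deck $\mathcal{D}(G)$ of a graph $G$ with vertex set $\{u_1,\ldots,u_n\}$ is the multiset of its vertex-deleted unlabeled subgraphs (i.e., considered up to isomorphism) $G-u_i$, $i=1,\ldots,n$. A graph $H$ is a reconstruction of $G$ if $\mathcal{D}(H)=\mathcal{D}(G)$. $G$ is reconstructible if every reconstruction of $G$ is isomorphic to $G$. For a graph $F$ on $k$ (ordered) vertices with adjacency matrix $A=A(F)$, let $e$ denote the all-ones vector of dimension $k$. An eigenvalue of $F$ (i.e., of $A$) is a main eigenvalue if the corresponding eigenspace is not orthogonal to $e$. $F$ is almost controllable if it has exactly $k-1$ (distinct) main eigenvalues; $\mathcal{H}_k$ denotes the set of all almost controllable graphs on $k$ vertices. The walk matrix of $F$ is $W(F)=[e,Ae,\ldots,A^{k-1}e]$; its rank equals the number of main eigenvalues of $F$, so $\operatorname{rank} W(F)=k-1$ for $F\in\mathcal{H}_k$.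 For $F\in\mathcal{H}_k$ define $$Q_0(F)=I_k-\frac{2\xi\xi^{\mathrm T}}{\xi^{\mathrm T}\xi},$$ where $\xi=(a_1,\ldots,a_k)^{\mathrm T}$ is the unique (up to sign) nonzero integral vector satisfying $W(F)^{\mathrm T}\xi=0$ and $\gcd(a_1,\ldots,a_k)=1$. The set $\mathcal{H}_k$ is partitioned into $\mathcal{H}_k^s$, consisting of those $F\in\mathcal{H}_k$ for which $Q_0(F)$ is a permutation matrix (equivalently, $F$ has a nontrivial automorphism), and $\mathcal{H}_k^a=\mathcal{H}_k\setminus\mathcal{H}_k^s$. The adjacency matrix of $G-u_n$ (and hence $Q_0(G-u_n)$) is taken with respect to the vertex ordering $u_1,\ldots,u_{n-1}$. -}

module Defs where

open import Level using (0ℓ)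
open import Algebra.Bundles using (RawSemiring)
import Algebra.Definitions.RawSemiring as RawSemiringDefinitions
open import Data.Bool.Base using (Bool; true; false; if_then_else_)
open import Data.Fin.Base using (Fin; zero; suc; toℕ; punchIn)
open import Data.Fin.Permutation using (Permutation; _⟨$⟩ʳ_)
open import Data.Fin.Properties using (_≟_)
open import Data.Integer.Base as ℤ using (ℤ; +_; -[1+_]; 0ℤ; 1ℤ)
open import Data.Integer.GCD using (gcd)
import Data.Integer.Properties as ℤ
open import Data.Nat.Base as ℕ using (ℕ; pred)
open import Data.Nat.GeneralisedArithmetic using (fold)
import Data.Nat.Properties as ℕ
open import Data.Product.Base using (∃-syntax; Σ-syntax; _×_; _,_)
open import Data.Rational.Base as ℚ using (ℚ; 0ℚ; 1ℚ; ½; Positive)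
import Data.Rational.Properties as ℚ
open import Data.Rational.Solver using (module +-*-Solver)
open import Data.Sum.Base using (_⊎_; inj₁; inj₂)
open import Data.Vec.Functional using (Vector; foldr; transpose)
open import Function.Base using (_∘_)
open import Relation.Binary.PropositionalEquality
  using (_≡_; refl; sym; trans; cong; cong₂; subst)
open import Relation.Nullary using (¬_; does)

record ℝ : Set where
  constructor mkℝ
  field
    seq    : ℕ → ℚ
    cauchy : ∀ ε → .{{Positive ε}} →
             ∃[ N ] ∀ {m n} → N ℕ.≤ m → N ℕ.≤ n →
             ℚ.∣ seq m ℚ.- seq n ∣ ℚ.≤ ε

open ℝ public

infix 4 _≃_

_≃_ : ℝ → ℝ → Set
x ≃ y = ∀ ε → .{{Positive ε}} →
        ∃[ N ] ∀ {n} → N ℕ.≤ n → ℚ.∣ seq x n ℚ.- seq y n ∣ ℚ.≤ ε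

fromℚ : ℚ → ℝ
fromℚ q = mkℝ (λ _ → q) λ ε {{ε>0}} → 0 , λ _ _ →
  subst (ℚ._≤ ε) (sym (cong ℚ.∣_∣ (ℚ.+-inverseʳ q)))
        (ℚ.<⇒≤ (ℚ.positive⁻¹ ε {{ε>0}}))

private
  half-pos : ∀ ε → .{{Positive ε}} → Positive (½ ℚ.* ε)
  half-pos ε = ℚ.pos*pos⇒pos ½ ε

  sum-close : ∀ {ε p q} → ℚ.∣ p ∣ ℚ.≤ ½ ℚ.* ε → ℚ.∣ q ∣ ℚ.≤ ½ ℚ.* ε →
              ℚ.∣ p ℚ.+ q ∣ ℚ.≤ ε
  sum-close {ε} {p} {q} p≤ q≤ = begin
      ℚ.∣ p ℚ.+ q ∣         ≤⟨ ℚ.∣p+q∣≤∣p∣+∣q∣ p q ⟩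
      ℚ.∣ p ∣ ℚ.+ ℚ.∣ q ∣   ≤⟨ ℚ.+-mono-≤ p≤ q≤ ⟩
      ½ ℚ.* ε ℚ.+ ½ ℚ.* ε   ≡⟨ sym (ℚ.*-distribʳ-+ ε ½ ½) ⟩
      1ℚ ℚ.* ε              ≡⟨ ℚ.*-identityˡ ε ⟩
      ε                     ∎
    where open ℚ.≤-Reasoning

  +-split : ∀ a b c d →
            (a ℚ.- c) ℚ.+ (b ℚ.- d) ≡ (a ℚ.+ b) ℚ.- (c ℚ.+ d)
  +-split = solve 4 (λ a b c d →
    (a :- c) :+ (b :- d) := (a :+ b) :- (c :+ d)) refl
    where open +-*-Solver

  *-split : ∀ a b c d →
            a ℚ.* (b ℚ.- d) ℚ.+ d ℚ.* (a ℚ.- c) ≡ a ℚ.* b ℚ.- c ℚ.* d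
  *-split = solve 4 (λ a b c d →
    a :* (b :- d) :+ d :* (a :- c) := a :* b :- c :* d) refl
    where open +-*-Solver

  from-base : ∀ a b → a ≡ b ℚ.+ (a ℚ.- b)
  from-base = solve 2 (λ a b → a := b :+ (a :- b)) refl
    where open +-*-Solver

  eventually-bounded : ∀ x → ∃[ B ] Positive B ×
                       ∃[ N ] ∀ {n} → N ℕ.≤ n → ℚ.∣ seq x n ∣ ℚ.≤ B
  eventually-bounded x with cauchy x 1ℚ
  ... | N , close = B , B>0 , N , bound
    where
    open ℚ.≤-Reasoning
    a B : ℚ
    a = seq x N
    B = ℚ.∣ a ∣ ℚ.+ 1ℚ
    B>0 : Positive B
    B>0 = ℚ.nonNeg+pos⇒pos ℚ.∣ a ∣ {{ℚ.∣-∣-nonNeg a}} 1ℚ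
    bound : ∀ {n} → N ℕ.≤ n → ℚ.∣ seq x n ∣ ℚ.≤ B
    bound {n} N≤n = begin
      ℚ.∣ seq x n ∣                     ≡⟨ cong ℚ.∣_∣ (from-base (seq x n) a) ⟩
      ℚ.∣ a ℚ.+ (seq x n ℚ.- a) ∣       ≤⟨ ℚ.∣p+q∣≤∣p∣+∣q∣ a (seq x n ℚ.- a) ⟩
      ℚ.∣ a ∣ ℚ.+ ℚ.∣ seq x n ℚ.- a ∣   ≤⟨ ℚ.+-monoʳ-≤ ℚ.∣ a ∣ (close N≤n ℕ.≤-refl) ⟩
      B                                 ∎

  -- A tolerance δ on a factor that keeps its product with anything bounded
  -- by B within η.
  tolerance : ∀ η B → .(Positive η) → .(Positive B) →
              ∃[ δ ] Positive δ ×
              (∀ {p q} → ℚ.∣ p ∣ ℚ.≤ B → ℚ.∣ q ∣ ℚ.≤ δ → ℚ.∣ p ℚ.* q ∣ ℚ.≤ η)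
  tolerance η B η>0 B>0 = δ , δ>0 , λ {p} {q} p≤B q≤δ → begin
      ℚ.∣ p ℚ.* q ∣         ≡⟨ ℚ.∣p*q∣≡∣p∣*∣q∣ p q ⟩
      ℚ.∣ p ∣ ℚ.* ℚ.∣ q ∣   ≤⟨ ℚ.*-monoʳ-≤-nonNeg ℚ.∣ q ∣ {{ℚ.∣-∣-nonNeg q}} p≤B ⟩
      B ℚ.* ℚ.∣ q ∣         ≤⟨ ℚ.*-monoˡ-≤-nonNeg B {{ℚ.pos⇒nonNeg B {{B>0}}}} q≤δ ⟩
      B ℚ.* (B⁻¹ ℚ.* η)     ≡⟨ sym (ℚ.*-assoc B B⁻¹ η) ⟩
      (B ℚ.* B⁻¹) ℚ.* η     ≡⟨ cong (ℚ._* η) (ℚ.*-inverseʳ B {{ℚ.pos⇒nonZero B {{B>0}}}}) ⟩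
      1ℚ ℚ.* η              ≡⟨ ℚ.*-identityˡ η ⟩
      η                     ∎
    where
    open ℚ.≤-Reasoning
    B⁻¹ δ : ℚ
    B⁻¹ = (ℚ.1/ B) {{ℚ.pos⇒nonZero B {{B>0}}}}
    δ = B⁻¹ ℚ.* η
    δ>0 : Positive δ
    δ>0 = ℚ.pos*pos⇒pos B⁻¹ {{ℚ.1/pos⇒pos B {{B>0}}}} η {{η>0}}

infixl 6 _+ℝ_
infixl 7 _*ℝ_

_+ℝ_ : ℝ → ℝ → ℝ
x +ℝ y = mkℝ (λ n → seq x n ℚ.+ seq y n) λ ε {{ε>0}} →
  let M , close-x = cauchy x (½ ℚ.* ε) {{half-pos ε {{ε>0}}}}
      N , close-y = cauchy y (½ ℚ.* ε) {{half-pos ε {{ε>0}}}}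
  in M ℕ.⊔ N , λ {m} {n} m≥ n≥ →
    subst (λ d → ℚ.∣ d ∣ ℚ.≤ ε) (+-split (seq x m) (seq y m) (seq x n) (seq y n))
      (sum-close (close-x (ℕ.m⊔n≤o⇒m≤o M N m≥) (ℕ.m⊔n≤o⇒m≤o M N n≥))
                 (close-y (ℕ.m⊔n≤o⇒n≤o M N m≥) (ℕ.m⊔n≤o⇒n≤o M N n≥)))

_*ℝ_ : ℝ → ℝ → ℝ
x *ℝ y = mkℝ (λ n → seq x n ℚ.* seq y n) λ ε {{ε>0}} →
  let X , X>0 , K , x≤X = eventually-bounded x
      Y , Y>0 , L , y≤Y = eventually-bounded y
      η>0               = half-pos ε {{ε>0}}
      α , α>0 , x*small = tolerance (½ ℚ.* ε) X η>0 X>0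
      β , β>0 , y*small = tolerance (½ ℚ.* ε) Y η>0 Y>0
      M , close-y       = cauchy y α {{α>0}}
      N , close-x       = cauchy x β {{β>0}}
      P                 = K ℕ.⊔ L
      Q                 = M ℕ.⊔ N
  in P ℕ.⊔ Q , λ {m} {n} m≥ n≥ →
    let m≥P = ℕ.m⊔n≤o⇒m≤o P Q m≥
        m≥Q = ℕ.m⊔n≤o⇒n≤o P Q m≥
        n≥P = ℕ.m⊔n≤o⇒m≤o P Q n≥
        n≥Q = ℕ.m⊔n≤o⇒n≤o P Q n≥
    in subst (λ d → ℚ.∣ d ∣ ℚ.≤ ε) (*-split (seq x m) (seq y m) (seq x n) (seq y n))
      (sum-close
        (x*small (x≤X (ℕ.m⊔n≤o⇒m≤o K L m≥P))
                 (close-y (ℕ.m⊔n≤o⇒m≤o M N m≥Q) (ℕ.m⊔n≤o⇒m≤o M N n≥Q)))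
        (y*small (y≤Y (ℕ.m⊔n≤o⇒n≤o K L n≥P))
                 (close-x (ℕ.m⊔n≤o⇒n≤o M N m≥Q) (ℕ.m⊔n≤o⇒n≤o M N n≥Q))))

+-*-rawSemiringℝ : RawSemiring 0ℓ 0ℓ
+-*-rawSemiringℝ = record
  { _≈_ = _≃_
  ; _+_ = _+ℝ_
  ; _*_ = _*ℝ_
  ; 0#  = fromℚ 0ℚ
  ; 1#  = fromℚ 1ℚ
  }

record Graph (n : ℕ) : Set where
  field
    adj         : Fin n → Fin n → Bool
    symmetric   : ∀ i j → adj i j ≡ adj j i
    irreflexive : ∀ i → adj i i ≡ false

open Graph public

infix 4 _≅_

_≅_ : ∀ {m n} → Graph m → Graph n → Set
_≅_ {m} {n} G H = Σ[ π ∈ Permutation m n ]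
  (∀ i j → adj G i j ≡ adj H (π ⟨$⟩ʳ i) (π ⟨$⟩ʳ j))

infixl 6 _∖_

-- The remaining vertices keep their relative order.
_∖_ : ∀ {n} → Graph n → Fin n → Graph (pred n)
_∖_ {ℕ.suc n} G u = record
  { adj         = λ i j → adj G (punchIn u i) (punchIn u j)
  ; symmetric   = λ i j → symmetric G (punchIn u i) (punchIn u j)
  ; irreflexive = λ i → irreflexive G (punchIn u i)
  }

-- The decks, as multisets of isomorphism classes, are equal when their cards
-- can be matched up to isomorphism.
IsReconstruction : ∀ {m n} → Graph m → Graph n → Set
IsReconstruction {m} {n} H G = Σ[ φ ∈ Permutation m n ]
  (∀ i → H ∖ i ≅ G ∖ (φ ⟨$⟩ʳ i))

Reconstructible : ∀ {n} → Graph n → Set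
Reconstructible G = ∀ {m} (H : Graph m) → IsReconstruction H G → H ≅ G

module LinearAlgebra (R : RawSemiring 0ℓ 0ℓ) where
  open RawSemiring R
  open RawSemiringDefinitions R using (sum)

  Matrix : ℕ → ℕ → Set
  Matrix m n = Vector (Vector Carrier n) m

  infixl 7 _·_ _*ᵥ_

  _·_ : ∀ {n} → Vector Carrier n → Vector Carrier n → Carrier
  x · y = sum (λ i → x i * y i)

  _*ᵥ_ : ∀ {m n} → Matrix m n → Vector Carrier n → Vector Carrier m
  (M *ᵥ x) i = M i · x

  ones : ∀ {n} → Vector Carrier n
  ones _ = 1#

  indicator : Bool → Carrier
  indicator b = if b then 1# else 0#

  identityMatrix : ∀ {n} → Matrix n n
  identityMatrix i j = indicator (does (i ≟ j))

  permutationMatrix : ∀ {n} → Permutation n n → Matrix n n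
  permutationMatrix π i j = indicator (does (π ⟨$⟩ʳ i ≟ j))

  adjacencyMatrix : ∀ {n} → Graph n → Matrix n n
  adjacencyMatrix G i j = indicator (adj G i j)

module Linℤ = LinearAlgebra ℤ.+-*-rawSemiring
module Linℚ = LinearAlgebra ℚ.+-*-rawSemiring
module Linℝ = LinearAlgebra +-*-rawSemiringℝ

module _ {k} (F : Graph k) where
  open Linℝ

  InEigenspace : ℝ → Vector ℝ k → Set
  InEigenspace μ v = ∀ i → (adjacencyMatrix F *ᵥ v) i ≃ μ *ℝ v i

  IsEigenvalue : ℝ → Set
  IsEigenvalue μ = ∃[ v ] ¬ (∀ i → v i ≃ fromℚ 0ℚ) × InEigenspace μ v

  IsMainEigenvalue : ℝ → Set
  IsMainEigenvalue μ =
    IsEigenvalue μ × ¬ (∀ v → InEigenspace μ v → ones · v ≃ fromℚ 0ℚ)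

  -- The double negation avoids asking for a procedure that locates a given
  -- main eigenvalue in the list; classically it can be dropped.
  HasExactlyMainEigenvalues : ℕ → Set
  HasExactlyMainEigenvalues r = Σ[ μ ∈ Vector ℝ r ]
    (∀ i → IsMainEigenvalue (μ i)) ×
    (∀ i j → μ i ≃ μ j → i ≡ j) ×
    (∀ ν → IsMainEigenvalue ν → ¬ ¬ (∃[ i ] ν ≃ μ i))

  -- Only meaningful for k ≥ 1.
  AlmostControllable : Set
  AlmostControllable = HasExactlyMainEigenvalues (pred k)

walkMatrix : ∀ {k} → Graph k → Linℤ.Matrix k k
walkMatrix F i j = fold ones (adjacencyMatrix F *ᵥ_) (toℕ j) i
  where open Linℤ

-- For an almost controllable graph this vector exists and is unique up to
-- sign; Q₀ does not depend on the sign.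
record WalkNormal {k} (F : Graph k) : Set where
  field
    ξ         : Vector ℤ k
    kernel    : ∀ j → (transpose (walkMatrix F) Linℤ.*ᵥ ξ) j ≡ 0ℤ
    nonzero   : ¬ (∀ i → ξ i ≡ 0ℤ)
    coprime   : foldr gcd 0ℤ ξ ≡ 1ℤ

private
  square : ∀ i → i ℤ.* i ≡ + (ℤ.∣ i ∣ ℕ.* ℤ.∣ i ∣)
  square (+ n)    = sym (ℤ.pos-* n n)
  square -[1+ n ] = refl

  sum-of-squares : ∀ {k} (x : Vector ℤ k) →
    ∃[ s ] (x Linℤ.· x ≡ + s) × (s ≡ 0 → ∀ i → x i ≡ 0ℤ)
  sum-of-squares {ℕ.zero}  x = 0 , refl , λ _ ()
  sum-of-squares {ℕ.suc k} x with sum-of-squares (x ∘ suc)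
  ... | s , eq , definite = a ℕ.* a ℕ.+ s , cong₂ ℤ._+_ (square (x zero)) eq , zeros
    where
    a : ℕ
    a = ℤ.∣ x zero ∣
    zeros : a ℕ.* a ℕ.+ s ≡ 0 → ∀ i → x i ≡ 0ℤ
    zeros p zero with ℕ.m*n≡0⇒m≡0∨n≡0 a (ℕ.m+n≡0⇒m≡0 (a ℕ.* a) p)
    ... | inj₁ q = ℤ.∣i∣≡0⇒i≡0 q
    ... | inj₂ q = ℤ.∣i∣≡0⇒i≡0 q
    zeros p (suc i) = definite (ℕ.m+n≡0⇒n≡0 (a ℕ.* a) p) i

norm²-nonZero : ∀ {k} (x : Vector ℤ k) → ¬ (∀ i → x i ≡ 0ℤ) →
                ℕ.NonZero ℤ.∣ x Linℤ.· x ∣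
norm²-nonZero x x≢0 with sum-of-squares x
... | s , eq , definite =
  ℕ.≢-nonZero λ p → x≢0 (definite (trans (sym (cong ℤ.∣_∣ eq)) p))

-- ∣_∣ only converts the nonnegative integer ξᵀξ to the natural number that
-- rational division expects.
Q₀ : ∀ {k} {F : Graph k} → WalkNormal F → Linℚ.Matrix k k
Q₀ w i j = Linℚ.identityMatrix i j ℚ.-
  ((+ 2 ℤ.* (ξ i ℤ.* ξ j)) ℚ./ ℤ.∣ ξ Linℤ.· ξ ∣) {{norm²-nonZero ξ nonzero}}
  where open WalkNormal w

IsPermutationMatrix : ∀ {k} → Linℚ.Matrix k k → Set
IsPermutationMatrix {k} M = Σ[ π ∈ Permutation k k ]
  (∀ i j → M i j ≡ Linℚ.permutationMatrix π i j)

Hˢ : ∀ {k} → Graph k → Set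
Hˢ F = AlmostControllable F × Σ[ w ∈ WalkNormal F ] IsPermutationMatrix (Q₀ w)

Hᵃ : ∀ {k} → Graph k → Set
Hᵃ F = AlmostControllable F × ¬ Hˢ F

neighbourhood : ∀ {n} → Graph n → Fin n → Vector ℚ (pred n)
neighbourhood {ℕ.suc n} G u i = Linℚ.indicator (adj G u (punchIn u i))

IsBinary : ∀ {k} → Vector ℚ k → Set
IsBinary x = ∀ i → x i ≡ 0ℚ ⊎ x i ≡ 1ℚ

{-# OPTIONS --safe #-}
module Submission where

-- Write G as the card F = G − u with the neighbourhood b of u, and a
-- reconstruction of G, relabelled, as F with b′; let A be the adjacency matrix
-- of F on k vertices and e the all-ones vector.  Walks with fewer than n = k + 1
-- entries never visit all vertices, so the numbers of open walks and of closed
-- walks with at most k entries are determined by the deck.  Decomposing walks at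
-- their visits to u, the closed walks determine b·Aʲb and then the open walks
-- determine e·Aʲb, for j ≤ k − 2 in both cases.  Hence b′ − b is orthogonal to
-- e, Ae, …, Aᵏ⁻²e.  If F has k − 1 main eigenvalues these vectors are linearly
-- independent, because a relation p(A)e = 0 makes every main eigenvalue a root
-- of p; so b′ − b is a multiple of ξ, and b′·b′ = b·b leaves only b′ = b and
-- b′ = Q₀b.  The vector Aξ is orthogonal to e, …, Aᵏ⁻²e too, so it is a multiple
-- of ξ and Q₀ commutes with A: if Q₀ is a permutation matrix, it is an
-- automorphism of F carrying b to b′.

-- The counts fit without slack: walks with at most `k` entries give `j ≤ k − 2`, hence `k − 1`
-- equations on `b′ − b`, which is what corank one in dimension `k` requires; and a relation among
-- those `k − 1` vectors is a polynomial with `k − 1` coefficients vanishing at `k − 1` distinct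
-- numbers.
--
-- Only one quantity is new at each walk length, and it enters linearly with a known integer factor:
-- the number of entries for closed walks, two for open walks. It can therefore be solved for over
-- `ℚ`. The closed walks come before the open ones because an open walk may return to `u`, so that
-- the numbers `b·Aʲb` occur in its decomposition.
--
-- The obstacle is that equality of Cauchy reals is undecidable, which rules out elimination or case
-- distinctions over `ℝ`. All elimination takes place over `ℚ`. The reals only serve to refute a
-- rational dependency, and there it suffices that being zero is stable under double negation, since
-- being a main eigenvalue is itself a negative statement about eigenvectors.

open import Defs
open import Level using (0ℓ)
open import Algebra.Bundles using (CommutativeRing; RawRing; RawSemiring; Semiring)
import Algebra.Properties.CommutativeMonoid.Sum
import Algebra.Properties.Ring
import Algebra.Properties.Semiring.Mult
import Algebra.Properties.Semiring.Sum
import Algebra.Solver.Ring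
import Algebra.Solver.Ring.AlmostCommutativeRing as ACR
open import Data.Bool.Base using (Bool; true; false; if_then_else_; not; _∧_)
open import Data.Empty using (⊥-elim)
open import Data.Fin.Base using (Fin; zero; suc; toℕ; punchIn; inject₁)
open import Data.Fin.Permutation
  using (Permutation; _⟨$⟩ʳ_; _⟨$⟩ˡ_; ↔⇒≡; inverseʳ; insert; lift₀; flip; _∘ₚ_)
  renaming (id to idₚ)
open import Data.Fin.Properties using (_≟_; all?; ¬∀⟶∃¬; punchIn-injective; punchInᵢ≢i; toℕ-inject₁)
import Data.Fin.Properties as Fin
open import Data.Integer.Base as ℤ using (ℤ; +_; -[1+_]; 0ℤ; 1ℤ)
import Data.Integer.Properties as ℤ
open import Data.Maybe.Base using (Maybe; just; nothing)
open import Data.Nat.Base as ℕ using (ℕ; zero; suc; pred; _≤_; s≤s)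
open import Data.Nat.GeneralisedArithmetic using (fold)
open import Data.Nat.Induction using (<-rec)
import Data.Nat.Properties as ℕ
open import Data.Product.Base using (Σ-syntax; ∃-syntax; _×_; _,_; proj₁; proj₂)
open import Data.Rational.Base as ℚ using (ℚ; 0ℚ; 1ℚ; ½; Positive)
import Data.Rational.Properties as ℚ
open import Data.Rational.Unnormalised.Base as ℚᵘ using (mkℚᵘ; *≡*)
import Data.Rational.Unnormalised.Properties as ℚᵘ
open import Data.Sum.Base using (_⊎_; inj₁; inj₂; [_,_]′)
open import Data.Vec.Base using (Vec; []; _∷_; map)
open import Data.Vec.Functional using (Vector; insertAt)
open import Data.Vec.Functional.Properties using (insertAt-lookup; insertAt-punchIn)
open import Function.Base using (_∘_)
open import Function.Bundles using (Injection; mk⇔)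
open import Function.Properties.Inverse using (↔⇒↣)
import Relation.Binary.Reasoning.Setoid
open import Relation.Binary.PropositionalEquality as ≡ using (_≡_; _≢_; _≗_)
open import Relation.Nullary using (¬_; Dec; yes; no; does)
open import Relation.Nullary.Decidable using (dec-true; dec-false; does-⇔; decidable-stable)
open import Relation.Nullary.Negation using (contradiction)

-- Commutative rings

-- A difference a − b of natural numbers, as a coefficient, is the pair (a , b).
module DifferenceSolver (R : CommutativeRing 0ℓ 0ℓ) where
  open CommutativeRing R
  open Algebra.Properties.Semiring.Mult semiring using (×1-homo-*; ×-homo-+) renaming (_×_ to _×ᴿ_)
  open Algebra.Properties.Ring ring using (-‿distribˡ-*; -‿distribʳ-*; -‿involutive; -‿+-comm; -0#≈0#)
  open Relation.Binary.Reasoning.Setoid setoid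

  private
    coefficients : RawRing 0ℓ 0ℓ
    coefficients = record
      { Carrier = ℕ × ℕ
      ; _≈_ = _≡_
      ; _+_ = λ (a , b) (c , d) → a ℕ.+ c , b ℕ.+ d
      ; _*_ = λ (a , b) (c , d) → a ℕ.* c ℕ.+ b ℕ.* d , a ℕ.* d ℕ.+ b ℕ.* c
      ; -_  = λ (a , b) → b , a
      ; 0#  = 0 , 0
      ; 1#  = 1 , 0
      }

    ⟦_⟧ᶜ : ℕ × ℕ → Carrier
    ⟦ a , b ⟧ᶜ = a ×ᴿ 1# - b ×ᴿ 1#

    exchange : ∀ w x y z → (w + x) + (y + z) ≈ (w + y) + (x + z)
    exchange w x y z = begin
      (w + x) + (y + z)   ≈⟨ +-assoc w x (y + z) ⟩
      w + (x + (y + z))   ≈⟨ +-congˡ (+-assoc x y z) ⟨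
      w + ((x + y) + z)   ≈⟨ +-congˡ (+-congʳ (+-comm x y)) ⟩
      w + ((y + x) + z)   ≈⟨ +-congˡ (+-assoc y x z) ⟩
      w + (y + (x + z))   ≈⟨ +-assoc w y (x + z) ⟨
      (w + y) + (x + z)   ∎

    +-homo : ∀ p q → ⟦ RawRing._+_ coefficients p q ⟧ᶜ ≈ ⟦ p ⟧ᶜ + ⟦ q ⟧ᶜ
    +-homo (a , b) (c , d) = begin
      (a ℕ.+ c) ×ᴿ 1# - (b ℕ.+ d) ×ᴿ 1#
        ≈⟨ +-cong (×-homo-+ 1# a c) (-‿cong (×-homo-+ 1# b d)) ⟩
      (a ×ᴿ 1# + c ×ᴿ 1#) - (b ×ᴿ 1# + d ×ᴿ 1#)
        ≈⟨ +-congˡ (-‿+-comm _ _) ⟨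
      (a ×ᴿ 1# + c ×ᴿ 1#) + (- (b ×ᴿ 1#) - d ×ᴿ 1#)
        ≈⟨ exchange _ _ _ _ ⟩
      ⟦ a , b ⟧ᶜ + ⟦ c , d ⟧ᶜ ∎

    *-homo : ∀ p q → ⟦ RawRing._*_ coefficients p q ⟧ᶜ ≈ ⟦ p ⟧ᶜ * ⟦ q ⟧ᶜ
    *-homo (a , b) (c , d) = sym (begin
      (x - y) * (z - w)
        ≈⟨ distribʳ _ _ _ ⟩
      x * (z - w) + (- y) * (z - w)
        ≈⟨ +-cong (distribˡ _ _ _) (distribˡ _ _ _) ⟩
      (x * z + x * (- w)) + ((- y) * z + (- y) * (- w))
        ≈⟨ +-cong (+-congˡ (sym (-‿distribʳ-* x w)))
             (+-cong (sym (-‿distribˡ-* y z))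
               (trans (sym (-‿distribˡ-* y (- w)))
                 (trans (-‿cong (sym (-‿distribʳ-* y w))) (-‿involutive (y * w))))) ⟩
      (x * z - x * w) + (- (y * z) + y * w)
        ≈⟨ +-congˡ (+-comm _ _) ⟩
      (x * z - x * w) + (y * w - y * z)
        ≈⟨ exchange _ _ _ _ ⟩
      (x * z + y * w) + (- (x * w) - y * z)
        ≈⟨ +-congˡ (-‿+-comm _ _) ⟩
      (x * z + y * w) - (x * w + y * z)
        ≈⟨ +-cong (homo a c b d) (-‿cong (homo a d b c)) ⟨
      (a ℕ.* c ℕ.+ b ℕ.* d) ×ᴿ 1# - (a ℕ.* d ℕ.+ b ℕ.* c) ×ᴿ 1# ∎)
      where
      x = a ×ᴿ 1#
      y = b ×ᴿ 1#
      z = c ×ᴿ 1#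
      w = d ×ᴿ 1#
      homo : ∀ k l m n → (k ℕ.* l ℕ.+ m ℕ.* n) ×ᴿ 1# ≈ (k ×ᴿ 1#) * (l ×ᴿ 1#) + (m ×ᴿ 1#) * (n ×ᴿ 1#)
      homo k l m n = trans (×-homo-+ 1# (k ℕ.* l) (m ℕ.* n)) (+-cong (×1-homo-* k l) (×1-homo-* m n))

    morphism : coefficients ACR.-Raw-AlmostCommutative⟶ ACR.fromCommutativeRing R
    morphism = record
      { ⟦_⟧    = ⟦_⟧ᶜ
      ; +-homo = +-homo
      ; *-homo = *-homo
      ; -‿homo = λ (a , b) → sym (begin
          - (a ×ᴿ 1# - b ×ᴿ 1#)       ≈⟨ -‿+-comm _ _ ⟨
          - (a ×ᴿ 1#) - - (b ×ᴿ 1#)   ≈⟨ +-congˡ (-‿involutive _) ⟩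
          - (a ×ᴿ 1#) + b ×ᴿ 1#       ≈⟨ +-comm _ _ ⟩
          b ×ᴿ 1# - a ×ᴿ 1#           ∎)
      ; 0-homo = -‿inverseʳ 0#
      ; 1-homo = trans (+-cong (+-identityʳ 1#) -0#≈0#) (+-identityʳ 1#)
      }

    -- Pairs are not normalised: equal differences are recognised by their cross sums, and equality
    -- of these in `ℕ` implies equality of the differences in every commutative ring.
    equal? : ∀ p q → Maybe (⟦ p ⟧ᶜ ≈ ⟦ q ⟧ᶜ)
    equal? (a , b) (c , d) with a ℕ.+ d ℕ.≟ c ℕ.+ b
    ... | no _  = nothing
    ... | yes e = just (begin
      x - y               ≈⟨ +-identityʳ _ ⟨
      (x - y) + 0#        ≈⟨ +-congˡ (-‿inverseʳ w) ⟨
      (x - y) + (w - w)   ≈⟨ exchange _ _ _ _ ⟩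
      (x + w) + (- y - w) ≈⟨ +-cong (trans (sym (×-homo-+ 1# a d)) (trans (reflexive (≡.cong (_×ᴿ 1#) e)) (×-homo-+ 1# c b))) (+-comm _ _) ⟩
      (z + y) + (- w - y) ≈⟨ exchange _ _ _ _ ⟩
      (z - w) + (y - y)   ≈⟨ +-congˡ (-‿inverseʳ y) ⟩
      (z - w) + 0#        ≈⟨ +-identityʳ _ ⟩
      z - w               ∎)
      where
      x = a ×ᴿ 1#
      y = b ×ᴿ 1#
      z = c ×ᴿ 1#
      w = d ×ᴿ 1#

  open Algebra.Solver.Ring coefficients (ACR.fromCommutativeRing R) morphism equal? public

module RingIdentities (R : CommutativeRing 0ℓ 0ℓ) where
  open CommutativeRing R
  open DifferenceSolver R

  telescope : ∀ a b c → (a - b) + (b - c) ≈ a - c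
  telescope = solve 3 (λ a b c → (a :- b) :+ (b :- c) := a :- c) refl

  interchange : ∀ a b c d → (a - b) + (c - d) ≈ (a + c) - (b + d)
  interchange = solve 4 (λ a b c d → (a :- b) :+ (c :- d) := (a :+ c) :- (b :+ d)) refl

  [a-b]+b≈a : ∀ a b → (a - b) + b ≈ a
  [a-b]+b≈a = solve 2 (λ a b → (a :- b) :+ b := a) refl

  [a+b]-b≈a : ∀ a b → (a + b) - b ≈ a
  [a+b]-b≈a = solve 2 (λ a b → (a :+ b) :- b := a) refl

  ac-bc≈[a-b]c : ∀ a b c → a * c - b * c ≈ (a - b) * c
  ac-bc≈[a-b]c = solve 3 (λ a b c → a :* c :- b :* c := (a :- b) :* c) refl

  -[a-b]≈b-a : ∀ a b → - (a - b) ≈ b - a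
  -[a-b]≈b-a = solve 2 (λ a b → :- (a :- b) := b :- a) refl

-- Not a disjunction of `x ≈ 0#` and `y ≈ 0#`, because the reals give no means to decide between the
-- two.
NoZeroDivisors : CommutativeRing 0ℓ 0ℓ → Set
NoZeroDivisors R = ∀ x y → x * y ≈ 0# → ¬ x ≈ 0# → y ≈ 0#
  where open CommutativeRing R

-- Inner products and symmetric matrices

module LinearAlgebraProperties (R : CommutativeRing 0ℓ 0ℓ) where
  open CommutativeRing R hiding (zero)
  open LinearAlgebra (Semiring.rawSemiring semiring)
  open Algebra.Properties.Semiring.Sum semiring
  open Relation.Binary.Reasoning.Setoid setoid

  sum-zero : ∀ {n} {f : Vector Carrier n} → (∀ i → f i ≈ 0#) → sum f ≈ 0#
  sum-zero {n} {f} f≈0 = trans (sum-cong-≋ {n} {f} {λ _ → 0#} f≈0) (sum-replicate-zero n)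

  ·-cong : ∀ {n} {x x′ y y′ : Vector Carrier n} →
           (∀ i → x i ≈ x′ i) → (∀ i → y i ≈ y′ i) → x · y ≈ x′ · y′
  ·-cong x≈x′ y≈y′ = sum-cong-≋ (λ i → *-cong (x≈x′ i) (y≈y′ i))

  ·-comm : ∀ {n} (x y : Vector Carrier n) → x · y ≈ y · x
  ·-comm x y = sum-cong-≋ (λ i → *-comm (x i) (y i))

  ·-distribˡ : ∀ {n} (x y z : Vector Carrier n) → x · (λ i → y i + z i) ≈ x · y + x · z
  ·-distribˡ x y z = trans (sum-cong-≋ (λ i → distribˡ (x i) (y i) (z i)))
                           (∑-distrib-+ (λ i → x i * y i) (λ i → x i * z i))

  ·-scaleʳ : ∀ {n} (x : Vector Carrier n) a y → x · (λ i → a * y i) ≈ a * (x · y)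
  ·-scaleʳ x a y = trans (sum-cong-≋ (λ i → x∙yz≈y∙xz (x i) a (y i)))
                         (sym (*-distribˡ-sum a (λ i → x i * y i)))
    where open import Algebra.Properties.CommutativeSemigroup *-commutativeSemigroup using (x∙yz≈y∙xz)

  ·-minusˡ : ∀ {n} (x y z : Vector Carrier n) → (λ i → x i - y i) · z ≈ x · z - y · z
  ·-minusˡ x y z = begin
    (λ i → x i - y i) · z
      ≈⟨ [a+b]-b≈a _ (y · z) ⟨
    ((λ i → x i - y i) · z + y · z) - y · z
      ≈⟨ +-congʳ (trans (sym (∑-distrib-+ (λ i → (x i - y i) * z i) (λ i → y i * z i)))
                        (sum-cong-≋ (λ i → trans (sym (distribʳ (z i) (x i - y i) (y i)))
                                                 (*-congʳ ([a-b]+b≈a (x i) (y i)))))) ⟩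
    x · z - y · z ∎
    where open RingIdentities R

  ·-zeroʳ : ∀ {n} (x : Vector Carrier n) {y} → (∀ i → y i ≈ 0#) → x · y ≈ 0#
  ·-zeroʳ x y≈0 = sum-zero (λ i → trans (*-congˡ (y≈0 i)) (zeroʳ (x i)))

  ·-sumʳ : ∀ {m n} (x : Vector Carrier n) (Y : Matrix m n) →
           x · (λ i → sum (λ j → Y j i)) ≈ sum (λ j → x · Y j)
  ·-sumʳ x Y = trans (sum-cong-≋ (λ i → *-distribˡ-sum (x i) (λ j → Y j i)))
                     (∑-comm (λ i j → x i * Y j i))

  *ᵥ-adjoint : ∀ {m n} (M : Matrix m n) x y → (M *ᵥ x) · y ≈ x · ((λ j i → M i j) *ᵥ y)
  *ᵥ-adjoint M x y = begin
    sum (λ i → sum (λ j → M i j * x j) * y i)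
      ≈⟨ sum-cong-≋ (λ i → *-distribʳ-sum (y i) (λ j → M i j * x j)) ⟩
    sum (λ i → sum (λ j → M i j * x j * y i))
      ≈⟨ ∑-comm (λ i j → M i j * x j * y i) ⟩
    sum (λ j → sum (λ i → M i j * x j * y i))
      ≈⟨ sum-cong-≋ (λ j → trans
           (sum-cong-≋ (λ i → trans (*-congʳ (*-comm (M i j) (x j))) (*-assoc (x j) (M i j) (y i))))
           (sym (*-distribˡ-sum (x j) (λ i → M i j * y i)))) ⟩
    x · ((λ j i → M i j) *ᵥ y) ∎

  Symmetric : ∀ {n} → Matrix n n → Set
  Symmetric M = ∀ i j → M i j ≈ M j i

  *ᵥ-selfAdjoint : ∀ {n} {M : Matrix n n} → Symmetric M → ∀ x y → (M *ᵥ x) · y ≈ x · (M *ᵥ y)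
  *ᵥ-selfAdjoint {M = M} M-sym x y = trans (*ᵥ-adjoint M x y)
    (·-cong (λ _ → refl) (λ j → ·-cong (λ i → M-sym i j) (λ _ → refl)))

  fold-shift : ∀ {n} (M : Matrix n n) x m → fold (M *ᵥ x) (M *ᵥ_) m ≡ M *ᵥ fold x (M *ᵥ_) m
  fold-shift M x zero    = ≡.refl
  fold-shift M x (suc m) = ≡.cong (M *ᵥ_) (fold-shift M x m)

  power-selfAdjoint : ∀ {n} {M : Matrix n n} → Symmetric M → ∀ m x y →
                      fold x (M *ᵥ_) m · y ≈ x · fold y (M *ᵥ_) m
  power-selfAdjoint M-sym zero x y = refl
  power-selfAdjoint {M = M} M-sym (suc m) x y = begin
    (M *ᵥ fold x (M *ᵥ_) m) · y   ≈⟨ *ᵥ-selfAdjoint M-sym (fold x (M *ᵥ_) m) y ⟩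
    fold x (M *ᵥ_) m · (M *ᵥ y)   ≈⟨ power-selfAdjoint M-sym m x (M *ᵥ y) ⟩
    x · fold (M *ᵥ y) (M *ᵥ_) m   ≈⟨ reflexive (≡.cong (x ·_) (fold-shift M y m)) ⟩
    x · (M *ᵥ fold y (M *ᵥ_) m)   ∎

  power-cong : ∀ {n} (M : Matrix n n) {x y} → (∀ i → x i ≈ y i) →
               ∀ m i → fold x (M *ᵥ_) m i ≈ fold y (M *ᵥ_) m i
  power-cong M x≈y zero    = x≈y
  power-cong M x≈y (suc m) i = ·-cong (λ _ → refl) (power-cong M x≈y m)

  adjacency-symmetric : ∀ {n} (G : Graph n) → Symmetric (adjacencyMatrix G)
  adjacency-symmetric G i j = reflexive (≡.cong indicator (symmetric G i j))

-- Polynomials, their roots and walk vectors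

module Polynomials (R : CommutativeRing 0ℓ 0ℓ) (noZeroDivisors : NoZeroDivisors R) where

  open CommutativeRing R hiding (zero)
  open Algebra.Properties.Semiring.Sum semiring
  open Algebra.Properties.Ring ring
  open Relation.Binary.Reasoning.Setoid setoid
  open DifferenceSolver R using (solve; _:+_; _:*_; _:-_; _:=_)

  eval : ∀ {r} → Vector Carrier r → Carrier → Carrier
  eval {zero}  c x = 0#
  eval {suc r} c x = c zero + x * eval (c ∘ suc) x

  -- Meant for `g j = walks j · v` with an eigenvector `v`, where every application of the adjacency
  -- matrix contributes a factor `μ`.
  geometric-sum : ∀ {r} (c : Vector Carrier r) μ (g : ℕ → Carrier) →
                  (∀ j → g (suc j) ≈ μ * g j) →
                  sum (λ j → c j * g (toℕ j)) ≈ eval c μ * g 0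
  geometric-sum {zero}  c μ g step = sym (zeroˡ (g 0))
  geometric-sum {suc r} c μ g step = begin
    c zero * g 0 + sum (λ j → c (suc j) * g (suc (toℕ j)))
      ≈⟨ +-congˡ (geometric-sum (c ∘ suc) μ (g ∘ suc) (step ∘ suc)) ⟩
    c zero * g 0 + eval (c ∘ suc) μ * g 1
      ≈⟨ +-congˡ (*-congˡ (step 0)) ⟩
    c zero * g 0 + eval (c ∘ suc) μ * (μ * g 0)
      ≈⟨ factor (c zero) (eval (c ∘ suc) μ) μ (g 0) ⟩
    (c zero + μ * eval (c ∘ suc) μ) * g 0 ∎
    where
    factor : ∀ a e m x → a * x + e * (m * x) ≈ (a + m * e) * x
    factor = solve 4 (λ a e m x → a :* x :+ e :* (m :* x) := (a :+ m :* e) :* x) refl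

  -- Synthetic division by `x − μ`: the partial Horner values of `c` at `μ` are the coefficients of
  -- the quotient, and the remainder is `eval c μ`.
  quotient : ∀ {r} → Carrier → Vector Carrier (suc r) → Vector Carrier r
  quotient μ c zero    = eval (c ∘ suc) μ
  quotient μ c (suc j) = quotient μ (c ∘ suc) j

  eval-quotient : ∀ {r} μ (c : Vector Carrier (suc r)) x →
                  eval c x - eval c μ ≈ (x - μ) * eval (quotient μ c) x
  eval-quotient {zero} μ c x = begin
    (c zero + x * 0#) - (c zero + μ * 0#)   ≈⟨ +-cong (+-congˡ (zeroʳ x)) (-‿cong (+-congˡ (zeroʳ μ))) ⟩
    (c zero + 0#) - (c zero + 0#)           ≈⟨ -‿inverseʳ (c zero + 0#) ⟩
    0#                                      ≈⟨ zeroʳ (x - μ) ⟨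
    (x - μ) * 0#                            ∎
  eval-quotient {suc r} μ c x = begin
    (a + x * p) - (a + μ * q)          ≈⟨ rearrange a x μ p q ⟩
    x * (p - q) + (x - μ) * q          ≈⟨ +-congʳ (*-congˡ (eval-quotient μ (c ∘ suc) x)) ⟩
    x * ((x - μ) * s) + (x - μ) * q    ≈⟨ collect x (x - μ) s q ⟩
    (x - μ) * (q + x * s)              ∎
    where
    a = c zero
    p = eval (c ∘ suc) x
    q = eval (c ∘ suc) μ
    s = eval (quotient μ (c ∘ suc)) x
    rearrange : ∀ a x m p q → (a + x * p) - (a + m * q) ≈ x * (p - q) + (x - m) * q
    rearrange = solve 5 (λ a x m p q →
      (a :+ x :* p) :- (a :+ m :* q) := x :* (p :- q) :+ (x :- m) :* q) refl
    collect : ∀ x d s q → x * (d * s) + d * q ≈ d * (q + x * s)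
    collect = solve 4 (λ x d s q → x :* (d :* s) :+ d :* q := d :* (q :+ x :* s)) refl

  -- The entry `quotient μ c zero` is also the remainder of the tail `c ∘ suc`, so its vanishing is
  -- the root hypothesis of the recursive call.
  zero-quotient : ∀ {r} μ (c : Vector Carrier (suc r)) →
                  (∀ j → quotient μ c j ≈ 0#) → eval c μ ≈ 0# → ∀ j → c j ≈ 0#
  zero-quotient {zero} μ c q≈0 root zero = begin
    c zero            ≈⟨ +-identityʳ (c zero) ⟨
    c zero + 0#       ≈⟨ +-congˡ (zeroʳ μ) ⟨
    c zero + μ * 0#   ≈⟨ root ⟩
    0#                ∎
  zero-quotient {suc r} μ c q≈0 root zero = begin
    c zero                          ≈⟨ +-identityʳ (c zero) ⟨
    c zero + 0#                     ≈⟨ +-congˡ (trans (*-congˡ (q≈0 zero)) (zeroʳ μ)) ⟨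
    c zero + μ * eval (c ∘ suc) μ   ≈⟨ root ⟩
    0#                              ∎
  zero-quotient {suc r} μ c q≈0 root (suc j) =
    zero-quotient μ (c ∘ suc) (q≈0 ∘ suc) (q≈0 zero) j

  -- Dividing by `x − μ zero` removes one coefficient and one root. The other roots survive in the
  -- quotient because their distance to `μ zero` is nonzero.
  too-many-roots : ∀ {r} (c μ : Vector Carrier r) → (∀ i j → μ i ≈ μ j → i ≡ j) →
                   (∀ i → eval c (μ i) ≈ 0#) → ∀ j → c j ≈ 0#
  too-many-roots {suc r} c μ distinct roots =
    zero-quotient (μ zero) c
      (too-many-roots (quotient (μ zero) c) (μ ∘ suc)
        (λ i j eq → Fin.suc-injective (distinct (suc i) (suc j) eq)) quotient-root)
      (roots zero)
    where
    quotient-root : ∀ i → eval (quotient (μ zero) c) (μ (suc i)) ≈ 0#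
    quotient-root i = noZeroDivisors _ _
      (begin
        (μ (suc i) - μ zero) * eval (quotient (μ zero) c) (μ (suc i))
          ≈⟨ eval-quotient (μ zero) c (μ (suc i)) ⟨
        eval c (μ (suc i)) - eval c (μ zero)
          ≈⟨ +-cong (roots (suc i)) (-‿cong (roots zero)) ⟩
        0# - 0#
          ≈⟨ -‿inverseʳ 0# ⟩
        0# ∎)
      (λ eq → contradiction (distinct (suc i) zero (x∙y⁻¹≈ε⇒x≈y (μ (suc i)) (μ zero) eq)) λ ())

module Walks (R : RawSemiring 0ℓ 0ℓ) {k} (F : Graph k) where
  open RawSemiring R using (Carrier)
  open LinearAlgebra R

  -- Generic in the semiring because three instances meet: over `ℤ` these are the columns of
  -- `walkMatrix`, the linear algebra is done over `ℚ`, and the eigenvalues live in `ℝ`.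
  walks : ℕ → Vector Carrier k
  walks = fold ones (adjacencyMatrix F *ᵥ_)

record Preserves (R : RawSemiring 0ℓ 0ℓ) (S : CommutativeRing 0ℓ 0ℓ)
                 (h : RawSemiring.Carrier R → CommutativeRing.Carrier S) : Set where
  open CommutativeRing S
  field
    h-+ : ∀ x y → h (RawSemiring._+_ R x y) ≈ h x + h y
    h-* : ∀ x y → h (RawSemiring._*_ R x y) ≈ h x * h y
    h-0 : h (RawSemiring.0# R) ≈ 0#
    h-1 : h (RawSemiring.1# R) ≈ 1#

-- The statements name LinearAlgebra directly rather than an instance of it: for
-- R = ℝ, matching the two up would unfold the moduli in the arithmetic of ℝ.
module WalkHomomorphism (R : RawSemiring 0ℓ 0ℓ) (S : CommutativeRing 0ℓ 0ℓ)
  (h : RawSemiring.Carrier R → CommutativeRing.Carrier S) (preserves : Preserves R S h) where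

  open CommutativeRing S hiding (zero)
  open Preserves preserves
  private
    module LS = LinearAlgebra (Semiring.rawSemiring semiring)
    open LinearAlgebraProperties S

  homo-· : ∀ {n} (x y : Vector (RawSemiring.Carrier R) n) →
           h (LinearAlgebra._·_ R x y) ≈ (h ∘ x) LS.· (h ∘ y)
  homo-· {zero}  x y = h-0
  homo-· {suc n} x y = trans
    (h-+ (RawSemiring._*_ R (x zero) (y zero)) (LinearAlgebra._·_ R (x ∘ suc) (y ∘ suc)))
    (+-cong (h-* (x zero) (y zero)) (homo-· (x ∘ suc) (y ∘ suc)))

  homo-indicator : ∀ b → h (LinearAlgebra.indicator R b) ≈ LS.indicator b
  homo-indicator true  = h-1
  homo-indicator false = h-0

  homo-adjacency : ∀ {k} (F : Graph k) v i →
    h (LinearAlgebra._*ᵥ_ R (LinearAlgebra.adjacencyMatrix R F) v i) ≈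
    (LS.adjacencyMatrix F LS.*ᵥ (h ∘ v)) i
  homo-adjacency F v i = trans (homo-· (LinearAlgebra.adjacencyMatrix R F i) v)
    (·-cong {y = h ∘ v} (λ j → homo-indicator (adj F i j)) (λ _ → refl))

  homo-ones : ∀ {n} (v : Vector (RawSemiring.Carrier R) n) →
              h (LinearAlgebra._·_ R (LinearAlgebra.ones R) v) ≈ LS.ones LS.· (h ∘ v)
  homo-ones v = trans (homo-· (LinearAlgebra.ones R) v) (·-cong {y = h ∘ v} (λ _ → h-1) (λ _ → refl))

  homo-walks : ∀ {k} (F : Graph k) m i →
               h (Walks.walks R F m i) ≈ Walks.walks (Semiring.rawSemiring semiring) F m i
  homo-walks F zero    i = h-1
  homo-walks F (suc m) i = trans (homo-adjacency F (Walks.walks R F m) i)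
    (·-cong {x = LS.adjacencyMatrix F i} (λ _ → refl) (homo-walks F m))

module WalkPolynomials (R : CommutativeRing 0ℓ 0ℓ) (noZeroDivisors : NoZeroDivisors R)
                       {k} (F : Graph k) where

  open CommutativeRing R hiding (zero)
  open LinearAlgebra (Semiring.rawSemiring semiring)
  open LinearAlgebraProperties R
  open Polynomials R noZeroDivisors
  open Algebra.Properties.Semiring.Sum semiring
  open Relation.Binary.Reasoning.Setoid setoid
  open Walks (Semiring.rawSemiring semiring) F

  private
    A : Matrix k k
    A = adjacencyMatrix F

  eigenvector-walks : ∀ {μ v} → (∀ i → (A *ᵥ v) i ≈ μ * v i) → ∀ m →
                      walks (suc m) · v ≈ μ * (walks m · v)
  eigenvector-walks {μ} {v} Av≈μv m = begin
    (A *ᵥ walks m) · v        ≈⟨ *ᵥ-selfAdjoint (adjacency-symmetric F) (walks m) v ⟩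
    walks m · (A *ᵥ v)        ≈⟨ ·-cong {x = walks m} (λ _ → refl) Av≈μv ⟩
    walks m · (λ i → μ * v i) ≈⟨ ·-scaleʳ (walks m) μ v ⟩
    μ * (walks m · v)         ∎

  -- A relation p(A)e = 0 gives p(μ)(e·v) = 0 for every eigenvector v.
  eval-annihilates : ∀ {r} (c : Vector Carrier r) →
    (∀ i → c · (λ j → walks (toℕ j) i) ≈ 0#) →
    ∀ {μ v} → (∀ i → (A *ᵥ v) i ≈ μ * v i) → eval c μ * (ones · v) ≈ 0#
  eval-annihilates c relation {μ} {v} Av≈μv = begin
    eval c μ * (ones · v)
      ≈⟨ geometric-sum c μ (λ j → walks j · v) (eigenvector-walks Av≈μv) ⟨
    sum (λ j → c j * (walks (toℕ j) · v))
      ≈⟨ sum-cong-≋ (λ j → *-congˡ {c j} (·-comm (walks (toℕ j)) v)) ⟩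
    sum (λ j → c j * (v · walks (toℕ j)))
      ≈⟨ sum-cong-≋ (λ j → ·-scaleʳ v (c j) (walks (toℕ j))) ⟨
    sum (λ j → v · (λ i → c j * walks (toℕ j) i))
      ≈⟨ ·-sumʳ v (λ j i → c j * walks (toℕ j) i) ⟨
    v · (λ i → c · (λ j → walks (toℕ j) i))
      ≈⟨ ·-zeroʳ v relation ⟩
    0# ∎

-- Linear dependence

DecidableZero Nontrivial : CommutativeRing 0ℓ 0ℓ → Set
DecidableZero R = ∀ x → Dec (x ≈ 0#)
  where open CommutativeRing R
Nontrivial R = ¬ 1# ≈ 0#
  where open CommutativeRing R

module LinearDependence (R : CommutativeRing 0ℓ 0ℓ)
  (_≟0 : DecidableZero R) (1≉0 : Nontrivial R) (noZeroDivisors : NoZeroDivisors R) where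

  open CommutativeRing R hiding (zero)
  open LinearAlgebra (Semiring.rawSemiring semiring) using (Matrix; _·_)
  open Algebra.Properties.Semiring.Sum semiring
  open Algebra.Properties.Ring ring
  open Relation.Binary.Reasoning.Setoid setoid
  open LinearAlgebraProperties R
  open DifferenceSolver R using (solve; _:+_; _:*_; _:-_; :-_; _:=_)

  Dependent : ∀ {m n} → Matrix m n → Set
  Dependent {m} V = Σ[ c ∈ Vector Carrier m ] ¬ (∀ j → c j ≈ 0#) × (∀ i → sum (λ j → c j * V j i) ≈ 0#)

  -- Gaussian elimination without division: a vector with nonzero first
  -- coordinate clears the first coordinates of the others.
  too-many-vectors : ∀ n (V : Matrix (suc n) n) → Dependent V
  too-many-vectors zero    V = (λ _ → 1#) , (λ 1≈0 → 1≉0 (1≈0 zero)) , λ ()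
  too-many-vectors (suc n) V with all? (λ j → V j zero ≟0)
  ... | yes V0≈0 =
    let c , c≉0 , relation = too-many-vectors n (λ j i → V (suc j) (suc i))
        extended : Vector Carrier (suc (suc n))
        extended = λ { zero → 0# ; (suc j) → c j }
    in extended , (λ e≈0 → c≉0 (e≈0 ∘ suc)) ,
       λ { zero → sum-zero (λ j → trans (*-congˡ {extended j} (V0≈0 j)) (zeroʳ (extended j)))
         ; (suc i) → trans (+-cong (zeroˡ (V zero (suc i))) (relation i)) (+-identityˡ 0#) }
  ... | no ¬V0≈0 with ¬∀⟶∃¬ _ _ (λ j → V j zero ≟0) ¬V0≈0
  ... | p , a≉0 = d , d≉0 , dependent
    where
    a : Carrier
    a = V p zero
    U : Matrix (suc n) (suc n)
    U j i = a * V (punchIn p j) i - V (punchIn p j) zero * V p i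
    ih : Dependent (λ j i → U j (suc i))
    ih = too-many-vectors n (λ j i → U j (suc i))
    c = proj₁ ih
    c≉0 = proj₁ (proj₂ ih)
    relation = proj₂ (proj₂ ih)
    s : Carrier
    s = sum (λ j → c j * V (punchIn p j) zero)
    -- Expanding the combination of the rows of `U` gives the other vectors the coefficients
    -- `a * c j` and the pivot the coefficient `- s`; since `a` is nonzero, this remains a
    -- nontrivial combination.
    d : Vector Carrier (suc (suc n))
    d = insertAt (λ j → a * c j) p (- s)
    d≉0 : ¬ (∀ j → d j ≈ 0#)
    d≉0 d≈0 = c≉0 λ j → noZeroDivisors _ _
      (trans (reflexive (≡.sym (insertAt-punchIn (λ j → a * c j) p (- s) j))) (d≈0 (punchIn p j))) a≉0
    sum-d : ∀ i → sum (λ j → d j * V j i) ≈ sum (λ j → c j * U j i)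
    sum-d i = begin
      sum (λ j → d j * V j i)
        ≈⟨ sum-remove {i = p} (λ j → d j * V j i) ⟩
      d p * V p i + sum (λ j → d (punchIn p j) * V (punchIn p j) i)
        ≈⟨ +-cong (*-congʳ (reflexive (insertAt-lookup (λ j → a * c j) p (- s))))
             (sum-cong-≋ (λ j → *-congʳ {V (punchIn p j) i} (reflexive (insertAt-punchIn (λ j → a * c j) p (- s) j)))) ⟩
      (- s) * V p i + sum (λ j → a * c j * V (punchIn p j) i)
        ≈⟨ +-congʳ (trans (negate s (V p i)) (*-distribˡ-sum (- V p i) (λ j → c j * V (punchIn p j) zero))) ⟩
      sum (λ j → (- V p i) * (c j * V (punchIn p j) zero)) + sum (λ j → a * c j * V (punchIn p j) i)
        ≈⟨ ∑-distrib-+ (λ j → (- V p i) * (c j * V (punchIn p j) zero)) (λ j → a * c j * V (punchIn p j) i) ⟨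
      sum (λ j → (- V p i) * (c j * V (punchIn p j) zero) + a * c j * V (punchIn p j) i)
        ≈⟨ sum-cong-≋ (λ j → collect (V p i) (c j) (V (punchIn p j) zero) a (V (punchIn p j) i)) ⟩
      sum (λ j → c j * U j i) ∎
      where
      negate : ∀ s v → (- s) * v ≈ (- v) * s
      negate = solve 2 (λ s v → (:- s) :* v := (:- v) :* s) refl
      collect : ∀ v c w a x → (- v) * (c * w) + a * c * x ≈ c * (a * x - w * v)
      collect = solve 5 (λ v c w a x → (:- v) :* (c :* w) :+ a :* c :* x := c :* (a :* x :- w :* v)) refl
    dependent : ∀ i → sum (λ j → d j * V j i) ≈ 0#
    dependent zero = trans (sum-d zero) (sum-zero λ j →
      trans (*-congˡ (vanish (V (punchIn p j) zero))) (zeroʳ (c j)))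
      where
      vanish : ∀ w → a * w - w * a ≈ 0#
      vanish w = trans (+-congʳ (*-comm a w)) (-‿inverseʳ (w * a))
    dependent (suc i) = trans (sum-d (suc i)) (relation i)

  -- A dependency among ξ, d and the rows of E splits into a combination of ξ
  -- and d and one of the rows, which are orthogonal, so that both vanish.
  corank-one : (∀ {n} (y : Vector Carrier n) → y · y ≈ 0# → ∀ i → y i ≈ 0#) →
    ∀ {n} (E : Matrix n (suc n)) → ¬ Dependent E →
    ∀ ξ d → (∀ j → ξ · E j ≈ 0#) → (∀ j → d · E j ≈ 0#) →
    ∀ i l → ξ i * d l ≈ ξ l * d i
  corank-one definite {n} E independent ξ d ξ⊥E d⊥E i l with (ξ i * d l - ξ l * d i) ≟0
  ... | yes D≈0 = x∙y⁻¹≈ε⇒x≈y (ξ i * d l) (ξ l * d i) D≈0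
  ... | no D≉0 = contradiction zeros c≉0
    where
    V : Matrix (suc (suc n)) (suc n)
    V zero          = ξ
    V (suc zero)    = d
    V (suc (suc j)) = E j
    c = proj₁ (too-many-vectors (suc n) V)
    c≉0 = proj₁ (proj₂ (too-many-vectors (suc n) V))
    relation = proj₂ (proj₂ (too-many-vectors (suc n) V))
    α = c zero
    β = c (suc zero)
    y s : Vector Carrier (suc n)
    y p = α * ξ p + β * d p
    s p = sum (λ j → c (suc (suc j)) * E j p)
    y+s≈0 : ∀ p → y p + s p ≈ 0#
    y+s≈0 p = trans (+-assoc (α * ξ p) (β * d p) (s p)) (relation p)
    y⊥E : ∀ j → y · E j ≈ 0#
    y⊥E j = begin
      y · E j
        ≈⟨ ·-comm y (E j) ⟩
      E j · y
        ≈⟨ ·-distribˡ (E j) (λ p → α * ξ p) (λ p → β * d p) ⟩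
      E j · (λ p → α * ξ p) + E j · (λ p → β * d p)
        ≈⟨ +-cong (vanish α ξ (ξ⊥E j)) (vanish β d (d⊥E j)) ⟩
      0# + 0#
        ≈⟨ +-identityˡ 0# ⟩
      0# ∎
      where
      vanish : ∀ a x → x · E j ≈ 0# → E j · (λ p → a * x p) ≈ 0#
      vanish a x x⊥E = trans (·-scaleʳ (E j) a x)
        (trans (*-congˡ (trans (·-comm (E j) x) x⊥E)) (zeroʳ a))
    y⊥s : y · s ≈ 0#
    y⊥s = trans (·-sumʳ y (λ j p → c (suc (suc j)) * E j p)) (sum-zero λ j →
      trans (·-scaleʳ y (c (suc (suc j))) (E j)) (trans (*-congˡ (y⊥E j)) (zeroʳ _)))
    y≈0 : ∀ p → y p ≈ 0#
    y≈0 = definite y (begin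
      y · y                    ≈⟨ +-identityʳ (y · y) ⟨
      y · y + 0#               ≈⟨ +-congˡ y⊥s ⟨
      y · y + y · s            ≈⟨ ·-distribˡ y y s ⟨
      y · (λ p → y p + s p)    ≈⟨ ·-zeroʳ y y+s≈0 ⟩
      0#                       ∎)
    s≈0 : ∀ p → s p ≈ 0#
    s≈0 p = trans (sym (+-identityˡ (s p))) (trans (+-congʳ (sym (y≈0 p))) (y+s≈0 p))
    -- Cramer's rule on the coordinates `i` and `l` of the vanishing vector `α ξ + β d`: with a
    -- nonzero minor, both `α` and `β` are zero.
    cramer : ∀ D′ → D′ ≈ 0# → ∀ a → (ξ i * d l - ξ l * d i) * a ≈ D′ → a ≈ 0#
    cramer D′ D′≈0 a eq = noZeroDivisors _ _ (trans eq D′≈0) D≉0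
    combine : ∀ p q u v → p ≈ 0# → q ≈ 0# → p * u - q * v ≈ 0#
    combine p q u v p≈0 q≈0 = begin
      p * u - q * v     ≈⟨ +-cong (trans (*-congʳ p≈0) (zeroˡ u)) (-‿cong (trans (*-congʳ q≈0) (zeroˡ v))) ⟩
      0# - 0#           ≈⟨ -‿inverseʳ 0# ⟩
      0#                ∎
    minors : ∀ a b x₁ x₂ d₁ d₂ →
      (x₁ * d₂ - x₂ * d₁) * a ≈ (a * x₁ + b * d₁) * d₂ - (a * x₂ + b * d₂) * d₁
    minors = solve 6 (λ a b x₁ x₂ d₁ d₂ → (x₁ :* d₂ :- x₂ :* d₁) :* a :=
      (a :* x₁ :+ b :* d₁) :* d₂ :- (a :* x₂ :+ b :* d₂) :* d₁) refl
    minors′ : ∀ a b x₁ x₂ d₁ d₂ →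
      (x₁ * d₂ - x₂ * d₁) * b ≈ (a * x₂ + b * d₂) * x₁ - (a * x₁ + b * d₁) * x₂
    minors′ = solve 6 (λ a b x₁ x₂ d₁ d₂ → (x₁ :* d₂ :- x₂ :* d₁) :* b :=
      (a :* x₂ :+ b :* d₂) :* x₁ :- (a :* x₁ :+ b :* d₁) :* x₂) refl
    -- Independence is a negation, so the coefficients of the rows vanish only up to double
    -- negation; deciding each one removes it.
    rows : ¬ ¬ (∀ j → c (suc (suc j)) ≈ 0#)
    rows c≉0′ = independent ((λ j → c (suc (suc j))) , c≉0′ , s≈0)
    zeros : ∀ j → c j ≈ 0#
    zeros zero = cramer _ (combine (y i) (y l) (d l) (d i) (y≈0 i) (y≈0 l)) α
                          (minors α β (ξ i) (ξ l) (d i) (d l))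
    zeros (suc zero) = cramer _ (combine (y l) (y i) (ξ i) (ξ l) (y≈0 l) (y≈0 i)) β
                                (minors′ α β (ξ i) (ξ l) (d i) (d l))
    zeros (suc (suc j)) with c (suc (suc j)) ≟0
    ... | yes p = p
    ... | no ¬p = contradiction (λ c≈0 → ¬p (c≈0 j)) rows

-- Kelly's lemma

module ℕ-Sum = Algebra.Properties.CommutativeMonoid.Sum ℕ.+-0-commutativeMonoid

avoids : ∀ {n m} → Vec (Fin n) m → Fin n → Bool
avoids []       v = true
avoids (x ∷ xs) v = not (does (v ≟ x)) ∧ avoids xs v

avoids-head : ∀ {n m} (x : Fin n) (xs : Vec (Fin n) m) → avoids (x ∷ xs) x ≡ false
avoids-head x xs = ≡.cong (λ b → not b ∧ avoids xs x) (dec-true (x ≟ x) ≡.refl)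

avoids-tail : ∀ {n m} {v x : Fin n} → v ≢ x → (xs : Vec (Fin n) m) → avoids (x ∷ xs) v ≡ avoids xs v
avoids-tail {v = v} {x} v≢x xs = ≡.cong (λ b → not b ∧ avoids xs v) (dec-false (v ≟ x) v≢x)

avoids-map : ∀ {k n m} {f : Fin k → Fin n} → (∀ {i j} → f i ≡ f j → i ≡ j) →
             ∀ (xs : Vec (Fin k) m) v → avoids (map f xs) (f v) ≡ avoids xs v
avoids-map injective []       v = ≡.refl
avoids-map {f = f} injective (x ∷ xs) v with v ≟ x
... | yes ≡.refl = avoids-head (f v) (map f xs)
... | no v≢x     = ≡.trans (avoids-tail (v≢x ∘ injective) (map f xs)) (avoids-map injective xs v)

avoids-punchIn : ∀ {n m} (v : Fin (suc n)) (xs : Vec (Fin n) m) → avoids (map (punchIn v) xs) v ≡ true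
avoids-punchIn v []       = ≡.refl
avoids-punchIn v (x ∷ xs) = ≡.trans (avoids-tail (punchInᵢ≢i v x ∘ ≡.sym) (map (punchIn v) xs))
                                    (avoids-punchIn v xs)

count : ∀ {n} → (Fin n → Bool) → ℕ
count P = ℕ-Sum.sum (λ v → if P v then 1 else 0)

count-cong : ∀ {n} {P Q : Fin n → Bool} → (∀ v → P v ≡ Q v) → count P ≡ count Q
count-cong P≗Q = ℕ-Sum.sum-cong-≗ (λ v → ≡.cong (if_then 1 else 0) (P≗Q v))

count-remove : ∀ {n} (P : Fin (suc n) → Bool) v →
               count P ≡ (if P v then 1 else 0) ℕ.+ count (P ∘ punchIn v)
count-remove P v = ℕ-Sum.sum-remove {i = v} (λ v → if P v then 1 else 0)

count-permute : ∀ {k n} (P : Fin n → Bool) (π : Permutation k n) → count (P ∘ (π ⟨$⟩ʳ_)) ≡ count P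
count-permute P π = ≡.sym (ℕ-Sum.sum-permute (λ v → if P v then 1 else 0) π)

count-true : ∀ n → count {n} (λ _ → true) ≡ n
count-true zero    = ≡.refl
count-true (suc n) = ≡.cong suc (count-true n)

count-avoids-punchIn : ∀ {n m} (v : Fin (suc n)) (xs : Vec (Fin n) m) →
                       count (avoids (map (punchIn v) xs)) ≡ suc (count (avoids xs))
count-avoids-punchIn v xs = ≡.trans (count-remove (avoids (map (punchIn v) xs)) v)
  (≡.cong₂ (λ b c → (if b then 1 else 0) ℕ.+ c) (avoids-punchIn v xs)
    (count-cong (avoids-map (punchIn-injective v _ _) xs)))

count-avoids-∷ : ∀ {n m} x (xs : Vec (Fin (suc n)) m) → count (avoids xs) ℕ.≤ suc (count (avoids (x ∷ xs)))
count-avoids-∷ x xs = begin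
  count (avoids xs)
    ≡⟨ count-remove (avoids xs) x ⟩
  (if avoids xs x then 1 else 0) ℕ.+ count (avoids xs ∘ punchIn x)
    ≤⟨ ℕ.+-monoˡ-≤ (count (avoids xs ∘ punchIn x)) (bit≤1 (avoids xs x)) ⟩
  suc (count (avoids xs ∘ punchIn x))
    ≡⟨ ≡.cong suc (count-cong (λ v → avoids-tail (punchInᵢ≢i x v) xs)) ⟨
  suc (count (avoids (x ∷ xs) ∘ punchIn x))
    ≡⟨ ≡.cong (λ b → suc ((if b then 1 else 0) ℕ.+ count (avoids (x ∷ xs) ∘ punchIn x))) (avoids-head x xs) ⟨
  suc ((if avoids (x ∷ xs) x then 1 else 0) ℕ.+ count (avoids (x ∷ xs) ∘ punchIn x))
    ≡⟨ ≡.cong suc (count-remove (avoids (x ∷ xs)) x) ⟨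
  suc (count (avoids (x ∷ xs))) ∎
  where
  open ℕ.≤-Reasoning
  bit≤1 : ∀ b → (if b then 1 else 0) ℕ.≤ 1
  bit≤1 true  = ℕ.≤-refl
  bit≤1 false = ℕ.z≤n

count-avoids-≥ : ∀ {n m} (xs : Vec (Fin (suc n)) m) → suc n ℕ.≤ m ℕ.+ count (avoids xs)
count-avoids-≥ {n} [] = ℕ.≤-reflexive (≡.sym (count-true (suc n)))
count-avoids-≥ {n} {suc m} (x ∷ xs) = begin
  suc n                                   ≤⟨ count-avoids-≥ xs ⟩
  m ℕ.+ count (avoids xs)                 ≤⟨ ℕ.+-monoʳ-≤ m (count-avoids-∷ x xs) ⟩
  m ℕ.+ suc (count (avoids (x ∷ xs)))     ≡⟨ ℕ.+-suc m _ ⟩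
  suc m ℕ.+ count (avoids (x ∷ xs))       ∎
  where open ℕ.≤-Reasoning

count-avoids-≢0 : ∀ {n m} (xs : Vec (Fin (suc n)) m) → m ℕ.< suc n → count (avoids xs) ≢ 0
count-avoids-≢0 {n} {m} xs m<n eq = ℕ.<⇒≱ m<n (ℕ.≤-trans (count-avoids-≥ xs)
  (ℕ.≤-reflexive (≡.trans (≡.cong (m ℕ.+_) eq) (ℕ.+-identityʳ m))))

module TupleSums (R : CommutativeRing 0ℓ 0ℓ) where
  open CommutativeRing R hiding (zero)
  open Algebra.Properties.Semiring.Sum semiring
  open Algebra.Properties.Semiring.Mult semiring using () renaming (_×_ to _×ᴿ_)
  open LinearAlgebraProperties R using (sum-zero)
  open Relation.Binary.Reasoning.Setoid setoid

  sumTuples : ∀ {n} m → (Vec (Fin n) m → Carrier) → Carrier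
  sumTuples zero    f = f []
  sumTuples (suc m) f = sum (λ x → sumTuples m (λ xs → f (x ∷ xs)))

  sumTuples-cong : ∀ {n} m {f g : Vec (Fin n) m → Carrier} → (∀ xs → f xs ≈ g xs) →
                   sumTuples m f ≈ sumTuples m g
  sumTuples-cong zero    f≈g = f≈g []
  sumTuples-cong (suc m) f≈g = sum-cong-≋ (λ x → sumTuples-cong m (λ xs → f≈g (x ∷ xs)))

  sumTuples-zero : ∀ {n} m {f : Vec (Fin n) m → Carrier} → (∀ xs → f xs ≈ 0#) → sumTuples m f ≈ 0#
  sumTuples-zero zero    f≈0 = f≈0 []
  sumTuples-zero (suc m) f≈0 = sum-zero (λ x → sumTuples-zero m (λ xs → f≈0 (x ∷ xs)))

  sum-sumTuples : ∀ {k n} m (f : Fin k → Vec (Fin n) m → Carrier) →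
                  sum (λ i → sumTuples m (f i)) ≈ sumTuples m (λ xs → sum (λ i → f i xs))
  sum-sumTuples zero    f = refl
  sum-sumTuples (suc m) f = trans (∑-comm (λ i x → sumTuples m (λ xs → f i (x ∷ xs))))
    (sum-cong-≋ (λ x → sum-sumTuples m (λ i xs → f i (x ∷ xs))))

  sumTuples-permute : ∀ {k n} m (f : Vec (Fin n) m → Carrier) (π : Permutation k n) →
                      sumTuples m (λ xs → f (map (π ⟨$⟩ʳ_) xs)) ≈ sumTuples m f
  sumTuples-permute zero    f π = refl
  sumTuples-permute (suc m) f π = trans
    (sum-cong-≋ (λ x → sumTuples-permute m (λ xs → f ((π ⟨$⟩ʳ x) ∷ xs)) π))
    (sym (sum-permute (λ x → sumTuples m (λ xs → f (x ∷ xs))) π))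

  sumTuples-punchIn : ∀ {n} m (f : Vec (Fin (suc n)) m → Carrier) v →
    sumTuples m (λ xs → f (map (punchIn v) xs)) ≈
    sumTuples m (λ xs → if avoids xs v then f xs else 0#)
  sumTuples-punchIn zero    f v = refl
  sumTuples-punchIn {n} (suc m) f v = begin
    sum (λ x → sumTuples m (λ xs → f (punchIn v x ∷ map (punchIn v) xs)))
      ≈⟨ sum-cong-≋ (λ x → trans (sumTuples-punchIn m (λ xs → f (punchIn v x ∷ xs)) v)
           (sumTuples-cong m (λ xs → reflexive (≡.cong (if_then f (punchIn v x ∷ xs) else 0#)
             (≡.sym (avoids-tail (punchInᵢ≢i v x ∘ ≡.sym) xs)))))) ⟩
    sum (λ x → g (punchIn v x))
      -- Restores the summand `x = v`, which is zero because no tuple starting with `v` avoids `v`.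
      ≈⟨ +-identityˡ _ ⟨
    0# + sum (λ x → g (punchIn v x))
      ≈⟨ +-congʳ (sumTuples-zero m (λ xs → reflexive (≡.cong (if_then f (v ∷ xs) else 0#) (avoids-head v xs)))) ⟨
    g v + sum (λ x → g (punchIn v x))
      ≈⟨ sum-remove {i = v} g ⟨
    sum g ∎
    where
    g : Fin (suc n) → Carrier
    g x = sumTuples m (λ xs → if avoids (x ∷ xs) v then f (x ∷ xs) else 0#)

  sum-count : ∀ {n} (P : Fin n → Bool) a → sum (λ v → if P v then a else 0#) ≈ count P ×ᴿ a
  sum-count {zero}  P a = refl
  sum-count {suc n} P a with P zero
  ... | true  = +-congˡ (sum-count (P ∘ suc) a)
  ... | false = trans (+-identityˡ _) (sum-count (P ∘ suc) a)

Reciprocals : (R : CommutativeRing 0ℓ 0ℓ) → (ℕ → CommutativeRing.Carrier R) → Set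
Reciprocals R 1/suc = ∀ n → suc n ×ᴿ 1/suc n ≈ 1#
  where
  open CommutativeRing R
  open Algebra.Properties.Semiring.Mult semiring using () renaming (_×_ to _×ᴿ_)

TorsionFree : CommutativeRing 0ℓ 0ℓ → Set
TorsionFree R = ∀ n x → suc n ×ᴿ x ≈ 0# → x ≈ 0#
  where
  open CommutativeRing R
  open Algebra.Properties.Semiring.Mult semiring using () renaming (_×_ to _×ᴿ_)

-- Instead of Kelly's counting of subgraphs of each isomorphism type, a tuple in
-- a card is weighted by the inverse of the number of cards it survives in.
module Kelly (R : CommutativeRing 0ℓ 0ℓ)
  (1/suc : ℕ → CommutativeRing.Carrier R) (1/suc-inverse : Reciprocals R 1/suc) where

  open CommutativeRing R hiding (zero)
  open Algebra.Properties.Semiring.Sum semiring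
  open Algebra.Properties.Semiring.Mult semiring using (×-comm-*) renaming (_×_ to _×ᴿ_)
  open Relation.Binary.Reasoning.Setoid setoid
  open TupleSums R

  -- Naturality serves two kinds of maps: isomorphisms, and the inclusions `punchIn v` of cards.
  Local : ℕ → Set
  Local m = Σ[ h ∈ (∀ {n} → Graph n → Vec (Fin n) m → Carrier) ]
    (∀ {k n} (F : Graph k) (G : Graph n) (f : Fin k → Fin n) →
     (∀ i j → adj F i j ≡ adj G (f i) (f j)) → ∀ xs → h F xs ≈ h G (map f xs))

  module _ {m : ℕ} (local : Local m) where

    private
      h = proj₁ local
      natural = proj₂ local

    total : ∀ {n} → Graph n → Carrier
    total G = sumTuples m (h G)

    -- The weight has to be computable inside the card. The `suc` accounts for the deleted vertex,
    -- which the tuple avoids as well but the card does not show.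
    weighted : ∀ {n} → Graph n → Carrier
    weighted F = sumTuples m (λ xs → h F xs * 1/suc (count (avoids xs)))

    total-cong : ∀ {k n} {F : Graph k} {G : Graph n} → F ≅ G → total F ≈ total G
    total-cong {F = F} {G} (π , iso) = trans
      (sumTuples-cong m (natural F G (π ⟨$⟩ʳ_) iso)) (sumTuples-permute m (h G) π)

    weighted-cong : ∀ {k n} {F : Graph k} {G : Graph n} → F ≅ G → weighted F ≈ weighted G
    weighted-cong {F = F} {G} (π , iso) = trans
      (sumTuples-cong m (λ xs → *-cong (natural F G (π ⟨$⟩ʳ_) iso xs)
        (reflexive (≡.cong 1/suc (≡.trans
          (count-cong (λ v → ≡.sym (avoids-map (Injection.injective (↔⇒↣ π)) xs v)))
          (count-permute (avoids (map (π ⟨$⟩ʳ_) xs)) π))))))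
      (sumTuples-permute m (λ xs → h G xs * 1/suc (count (avoids xs))) π)

    sum-weighted : ∀ {n} (G : Graph (suc n)) → m ℕ.< suc n →
                   sum (λ v → weighted (G ∖ v)) ≈ total G
    sum-weighted {n} G m<n = begin
      sum (λ v → weighted (G ∖ v))
        ≈⟨ sum-cong-≋ (λ v → sumTuples-cong m (λ xs → *-cong
             (natural (G ∖ v) G (punchIn v) (λ _ _ → ≡.refl) xs)
             (reflexive (≡.cong 1/suc (≡.cong pred (≡.sym (count-avoids-punchIn v xs))))))) ⟩
      sum (λ v → sumTuples m (λ xs → g (map (punchIn v) xs)))
        ≈⟨ sum-cong-≋ (sumTuples-punchIn m g) ⟩
      sum (λ v → sumTuples m (λ xs → if avoids xs v then g xs else 0#))
        ≈⟨ sum-sumTuples m (λ v xs → if avoids xs v then g xs else 0#) ⟩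
      sumTuples m (λ xs → sum (λ v → if avoids xs v then g xs else 0#))
        ≈⟨ sumTuples-cong m (λ xs → trans (sum-count (avoids xs) (g xs)) (normalise xs)) ⟩
      total G ∎
      where
      -- `1/suc (pred c)` is the reciprocal of `c` for nonzero `c`, and the count is nonzero because
      -- fewer than `suc n` entries cannot cover all vertices.
      g : Vec (Fin (suc n)) m → Carrier
      g xs = h G xs * 1/suc (pred (count (avoids xs)))
      normalise : ∀ xs → count (avoids xs) ×ᴿ g xs ≈ h G xs
      normalise xs with count (avoids xs) | count-avoids-≢0 xs m<n
      ... | zero  | ≢0 = contradiction ≡.refl ≢0
      ... | suc c | _  = trans (sym (×-comm-* (suc c) (h G xs) (1/suc c)))
                               (trans (*-congˡ (1/suc-inverse c)) (*-identityʳ (h G xs)))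

    total-reconstructible : ∀ {n} (H G : Graph (suc n)) → m ℕ.< suc n →
                            IsReconstruction H G → total H ≈ total G
    total-reconstructible H G m<n (φ , cards) = begin
      total H                               ≈⟨ sum-weighted H m<n ⟨
      sum (λ v → weighted (H ∖ v))          ≈⟨ sum-cong-≋ (λ v → weighted-cong {F = H ∖ v} {G ∖ (φ ⟨$⟩ʳ v)} (cards v)) ⟩
      sum (λ v → weighted (G ∖ (φ ⟨$⟩ʳ v))) ≈⟨ sum-permute (λ v → weighted (G ∖ v)) φ ⟨
      sum (λ v → weighted (G ∖ v))          ≈⟨ sum-weighted G m<n ⟩
      total G                               ∎

-- Walks through a vertex

module WalkCounts (R : CommutativeRing 0ℓ 0ℓ) where
  open CommutativeRing R hiding (zero)
  open LinearAlgebra (Semiring.rawSemiring semiring)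
  open LinearAlgebraProperties R
  open Algebra.Properties.Semiring.Sum semiring
  open Relation.Binary.Reasoning.Setoid setoid
  open TupleSums R

  column : ∀ {n} → Matrix n n → Fin n → Vector Carrier n
  column M a i = M i a

  pathWeight : ∀ {n m} → Matrix n n → Vector Carrier n → Fin n → Vec (Fin n) m → Carrier
  pathWeight M y x []       = y x
  pathWeight M y x (z ∷ zs) = M x z * pathWeight M y z zs

  sumTuples-scale : ∀ {n} m a (f : Vec (Fin n) m → Carrier) →
                    sumTuples m (λ xs → a * f xs) ≈ a * sumTuples m f
  sumTuples-scale zero    a f = refl
  sumTuples-scale (suc m) a f = trans
    (sum-cong-≋ (λ x → sumTuples-scale m a (λ xs → f (x ∷ xs))))
    (sym (*-distribˡ-sum a (λ x → sumTuples m (λ xs → f (x ∷ xs)))))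

  sum-pathWeight : ∀ {n} m (M : Matrix n n) y x →
                   sumTuples m (pathWeight M y x) ≈ fold y (M *ᵥ_) m x
  sum-pathWeight zero    M y x = refl
  sum-pathWeight (suc m) M y x = sum-cong-≋ (λ z →
    trans (sumTuples-scale m (M x z) (pathWeight M y z)) (*-congˡ (sum-pathWeight m M y z)))

  -- The end vector of `pathWeight` makes the difference: `ones` adds no step, while the column of
  -- the starting vertex adds the step that closes the walk. So `suc m` entries carry `m` steps when
  -- open and `suc m` steps when closed.
  openWalk closedWalk : ∀ {n m} → Graph n → Vec (Fin n) (suc m) → Carrier
  openWalk   G (x ∷ xs) = pathWeight (adjacencyMatrix G) ones x xs
  closedWalk G (x ∷ xs) = pathWeight (adjacencyMatrix G) (column (adjacencyMatrix G) x) x xs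

  pathWeight-map : ∀ {k n m} {M : Matrix k k} {N : Matrix n n} (f : Fin k → Fin n) →
    (∀ i j → M i j ≈ N (f i) (f j)) → ∀ {y z} → (∀ i → y i ≈ z (f i)) →
    ∀ x (xs : Vec (Fin k) m) → pathWeight M y x xs ≈ pathWeight N z (f x) (map f xs)
  pathWeight-map f M≈N y≈z x []       = y≈z x
  pathWeight-map f M≈N y≈z x (t ∷ ts) = *-cong (M≈N x t) (pathWeight-map f M≈N y≈z t ts)

  sum-openWalk : ∀ {n} m (G : Graph n) →
    sumTuples (suc m) (openWalk G) ≈ sum (fold ones (adjacencyMatrix G *ᵥ_) m)
  sum-openWalk m G = sum-cong-≋ (sum-pathWeight m (adjacencyMatrix G) ones)

  sum-closedWalk : ∀ {n} m (G : Graph n) →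
    sumTuples (suc m) (closedWalk G) ≈
    sum (λ a → fold (column (adjacencyMatrix G) a) (adjacencyMatrix G *ᵥ_) m a)
  sum-closedWalk m G = sum-cong-≋ (λ a →
    sum-pathWeight m (adjacencyMatrix G) (column (adjacencyMatrix G) a) a)

  identity-· : ∀ {n} (a : Fin n) x → identityMatrix a · x ≈ x a
  identity-· {suc n} zero x = begin
    1# * x zero + sum (λ i → 0# * x (suc i))
      ≈⟨ +-cong (*-identityˡ (x zero)) (sum-zero (λ i → zeroˡ (x (suc i)))) ⟩
    x zero + 0#
      ≈⟨ +-identityʳ (x zero) ⟩
    x zero ∎
  identity-· {suc n} (suc a) x = begin
    0# * x zero + sum (λ i → identityMatrix (suc a) (suc i) * x (suc i))
      ≈⟨ +-cong (zeroˡ (x zero)) (identity-· a (x ∘ suc)) ⟩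
    0# + x (suc a)
      ≈⟨ +-identityˡ (x (suc a)) ⟩
    x (suc a) ∎

  permutation-*ᵥ : ∀ {n} {Q : Matrix n n} (π : Permutation n n) →
    (∀ i j → Q i j ≈ permutationMatrix π i j) → ∀ x i → (Q *ᵥ x) i ≈ x (π ⟨$⟩ʳ i)
  permutation-*ᵥ π Q≈P x i = trans (·-cong {y = x} (Q≈P i) (λ _ → refl)) (identity-· (π ⟨$⟩ʳ i) x)

  column≈*ᵥ : ∀ {n} (M : Matrix n n) a i → column M a i ≈ (M *ᵥ identityMatrix a) i
  column≈*ᵥ M a i = sym (trans (·-comm (M i) (identityMatrix a)) (identity-· a (M i)))

  -- Both sides are entries of the power `m + 1` of `M`, at transposed positions, and powers of a
  -- symmetric matrix are symmetric.
  power-column-symmetric : ∀ {n} {M : Matrix n n} → Symmetric M → ∀ m a i →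
    fold (column M a) (M *ᵥ_) m i ≈ fold (column M i) (M *ᵥ_) m a
  power-column-symmetric {M = M} M-sym m a i = begin
    fold (column M a) (M *ᵥ_) m i
      ≈⟨ entry a i ⟩
    fold (identityMatrix a) (M *ᵥ_) (suc m) · identityMatrix i
      ≈⟨ power-selfAdjoint M-sym (suc m) (identityMatrix a) (identityMatrix i) ⟩
    identityMatrix a · fold (identityMatrix i) (M *ᵥ_) (suc m)
      ≈⟨ ·-comm (identityMatrix a) _ ⟩
    fold (identityMatrix i) (M *ᵥ_) (suc m) · identityMatrix a
      ≈⟨ entry i a ⟨
    fold (column M i) (M *ᵥ_) m a ∎
    where
    entry : ∀ a i → fold (column M a) (M *ᵥ_) m i ≈ fold (identityMatrix a) (M *ᵥ_) (suc m) · identityMatrix i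
    entry a i = begin
      fold (column M a) (M *ᵥ_) m i
        ≈⟨ power-cong M (column≈*ᵥ M a) m i ⟩
      fold (M *ᵥ identityMatrix a) (M *ᵥ_) m i
        ≈⟨ reflexive (≡.cong (λ x → x i) (fold-shift M (identityMatrix a) m)) ⟩
      fold (identityMatrix a) (M *ᵥ_) (suc m) i
        ≈⟨ identity-· i _ ⟨
      identityMatrix i · fold (identityMatrix a) (M *ᵥ_) (suc m)
        ≈⟨ ·-comm (identityMatrix i) _ ⟩
      fold (identityMatrix a) (M *ᵥ_) (suc m) · identityMatrix i ∎

  -- The deleted vertex is `zero`, so that `M` is the matrix `A` bordered by `b`, with corner zero.
  module Bordered {k} (F : Graph k) (G : Graph (suc k))
                  (block : ∀ i j → adj G (suc i) (suc j) ≡ adj F i j) where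

    A : Matrix k k
    A = adjacencyMatrix F

    M : Matrix (suc k) (suc k)
    M = adjacencyMatrix G

    b : Vector Carrier k
    b i = M zero (suc i)

    β : ℕ → Vector Carrier k
    β = fold b (A *ᵥ_)

    M-zero-zero : M zero zero ≈ 0#
    M-zero-zero = reflexive (≡.cong indicator (irreflexive G zero))

    -- The walks of length j + 2 from the vertex zero back to it, and those of
    -- length j + 1 from it to any vertex, that do not meet it in between.
    returns departures : ℕ → Carrier
    returns    j = β j · b
    departures j = β j · ones

    step-zero : ∀ x → (M *ᵥ x) zero ≈ b · (x ∘ suc)
    step-zero x = trans
      (+-congʳ (trans (*-congʳ M-zero-zero) (zeroˡ (x zero))))
      (+-identityˡ _)

    -- One step taken from inside the card either enters the vertex `zero`, which splits off a
    -- product, or stays inside; in the latter case the factor `A` moves to `y`, which thereby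
    -- records the stay.
    step-suc : ∀ y x → y · ((M *ᵥ x) ∘ suc) ≈ x zero * (y · b) + (A *ᵥ y) · (x ∘ suc)
    step-suc y x = begin
      y · ((M *ᵥ x) ∘ suc)
        ≈⟨ ·-cong {x = y} (λ _ → refl) (λ i → +-cong
             (trans (*-congʳ (reflexive (≡.cong indicator (symmetric G (suc i) zero)))) (*-comm (b i) (x zero)))
             (sum-cong-≋ (λ j → *-congʳ {x (suc j)} (reflexive (≡.cong indicator (block i j)))))) ⟩
      y · (λ i → x zero * b i + (A *ᵥ (x ∘ suc)) i)
        ≈⟨ ·-distribˡ y (λ i → x zero * b i) (A *ᵥ (x ∘ suc)) ⟩
      y · (λ i → x zero * b i) + y · (A *ᵥ (x ∘ suc))
        ≈⟨ +-cong (·-scaleʳ y (x zero) b) (sym (*ᵥ-selfAdjoint (adjacency-symmetric F) y (x ∘ suc))) ⟩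
      x zero * (y · b) + (A *ᵥ y) · (x ∘ suc) ∎

    power : Vector Carrier (suc k) → ℕ → Vector Carrier (suc k)
    power x = fold x (M *ᵥ_)

    -- Walks from `zero` whose first `j + 1` steps lead into the card and stay there, followed by
    -- `m` unrestricted steps with end weight `x`. Asking where the next step goes trades one unit
    -- of `m` for one of `j`.
    rest : Vector Carrier (suc k) → ℕ → ℕ → Carrier
    rest x m j = β j · (power x m ∘ suc)

    rest-column : ∀ j → rest (column M zero) 0 j ≈ returns j
    rest-column j = ·-cong {x = β j} (λ _ → refl)
      (λ i → reflexive (≡.cong indicator (symmetric G (suc i) zero)))

    rest-suc : ∀ x m j → rest x (suc m) j ≈ power x m zero * returns j + rest x m (suc j)
    rest-suc x m j = step-suc (β j) (power x m)

    power-zero : ∀ x m → power x (suc m) zero ≈ rest x m 0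
    power-zero x m = step-zero (power x m)

    -- As `rest`, but for walks that start at an arbitrary vertex of the card and spend their first
    -- `j` steps there.
    openRest : ℕ → ℕ → Carrier
    openRest m j = fold ones (A *ᵥ_) j · (power ones m ∘ suc)

    openRest-suc : ∀ m j → openRest (suc m) j ≈ power ones m zero * departures j + openRest m (suc j)
    openRest-suc m j = trans (step-suc (fold ones (A *ᵥ_) j) (power ones m))
      (+-congʳ (*-congˡ (trans (power-selfAdjoint (adjacency-symmetric F) j ones b) (·-comm ones (β j)))))

    openWalks≈ : ∀ m → sumTuples (suc m) (openWalk G) ≈ power ones m zero + openRest m 0
    openWalks≈ m = trans (sum-openWalk m G) (+-congˡ (sum-cong-≋ (λ i → sym (*-identityˡ (power ones m (suc i))))))

    closedRest : ℕ → ℕ → Carrier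
    closedRest m j = sum (λ i → fold (identityMatrix i) (A *ᵥ_) j · (power (column M (suc i)) m ∘ suc))

    -- A closed walk that starts in the card and first meets `zero` after `j` steps inside can be
    -- rotated to start at that visit. Read backwards, which symmetry of the powers permits, it
    -- leaves `zero`, stays in the card for those `j` steps and then returns freely: these are the
    -- walks of `rest (column M zero) m j`.
    closedRest-suc : ∀ m j → closedRest (suc m) j ≈ rest (column M zero) m j + closedRest m (suc j)
    closedRest-suc m j = begin
      sum (λ i → fold (identityMatrix i) (A *ᵥ_) j · (power (column M (suc i)) (suc m) ∘ suc))
        ≈⟨ sum-cong-≋ (λ i → step-suc (fold (identityMatrix i) (A *ᵥ_) j) (power (column M (suc i)) m)) ⟩
      sum (λ i → power (column M (suc i)) m zero * (fold (identityMatrix i) (A *ᵥ_) j · b)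
               + fold (identityMatrix i) (A *ᵥ_) (suc j) · (power (column M (suc i)) m ∘ suc))
        ≈⟨ ∑-distrib-+ (λ i → power (column M (suc i)) m zero * (fold (identityMatrix i) (A *ᵥ_) j · b)) _ ⟩
      sum (λ i → power (column M (suc i)) m zero * (fold (identityMatrix i) (A *ᵥ_) j · b)) + closedRest m (suc j)
        ≈⟨ +-congʳ (sum-cong-≋ (λ i → trans
             (*-cong (power-column-symmetric (adjacency-symmetric G) m (suc i) zero)
                     (trans (power-selfAdjoint (adjacency-symmetric F) j (identityMatrix i) b) (identity-· i (β j))))
             (*-comm _ (β j i)))) ⟩
      rest (column M zero) m j + closedRest m (suc j) ∎

    closedWalks≈ : ∀ m → sumTuples (suc m) (closedWalk G) ≈ power (column M zero) m zero + closedRest m 0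
    closedWalks≈ m = trans (sum-closedWalk m G)
      (+-congˡ (sum-cong-≋ (λ i → sym (identity-· i (power (column M (suc i)) m ∘ suc)))))

-- Comparing two graphs that share a card

module Comparison (R : CommutativeRing 0ℓ 0ℓ) (torsion-free : TorsionFree R)
  {k} (F : Graph k) (G G′ : Graph (suc k))
  (block  : ∀ i j → adj G  (suc i) (suc j) ≡ adj F i j)
  (block′ : ∀ i j → adj G′ (suc i) (suc j) ≡ adj F i j) where

  open CommutativeRing R hiding (zero)
  open LinearAlgebra (Semiring.rawSemiring semiring)
  open LinearAlgebraProperties R
  open Algebra.Properties.Semiring.Sum semiring
  open Algebra.Properties.Semiring.Mult semiring using (×-homo-+) renaming (_×_ to _×ᴿ_)
  open Algebra.Properties.Ring ring using (x∙y⁻¹≈ε⇒x≈y)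
  open Relation.Binary.Reasoning.Setoid setoid
  open TupleSums R
  open WalkCounts R
  open RingIdentities R
  private
    module B  = Bordered F G  block
    module B′ = Bordered F G′ block′

  -- Tracks how often the one quantity not yet known to agree, with discrepancy `δ`, enters a count.
  -- Being a record, it lets `n` and `δ` be inferred from the type.
  record _≈[_×_]_ (x : Carrier) (n : ℕ) (δ y : Carrier) : Set where
    constructor differ
    field
      difference : x - y ≈ n ×ᴿ δ

  open _≈[_×_]_

  difference-zero : ∀ {δ x y} → x ≈ y → x ≈[ 0 × δ ] y
  difference-zero {y = y} x≈y = differ (trans (+-congʳ x≈y) (-‿inverseʳ y))

  difference-+ : ∀ {δ m n x x′ y y′} → x ≈[ m × δ ] x′ → y ≈[ n × δ ] y′ →
                 (x + y) ≈[ m ℕ.+ n × δ ] (x′ + y′)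
  difference-+ {δ} {m} {n} {x} {x′} {y} {y′} (differ p) (differ q) = differ
    (trans (sym (interchange x x′ y y′)) (trans (+-cong p q) (sym (×-homo-+ δ m n))))

  difference-resp : ∀ {δ n x x′ y y′} → x ≈ y → x′ ≈ y′ → y ≈[ n × δ ] y′ → x ≈[ n × δ ] x′
  difference-resp x≈y x′≈y′ (differ p) = differ (trans (+-cong x≈y (-‿cong x′≈y′)) p)

  -- Serves both kinds of walks: the values `rest x 0 j` are `returns j` for the end vector
  -- `column M zero` and `departures j` for `ones`. Here `s` is the first index at which agreement
  -- is open; everything of lower order agrees, and the discrepancy `δ` at `s` is passed on with
  -- factor one.
  module Start (x x′ : Vector Carrier (suc k)) (x0≈x′0 : x zero ≈ x′ zero)
    (s : ℕ) (returns≈ : ∀ j → j ℕ.< s → B.returns j ≈ B′.returns j)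
    (rest≈₀ : ∀ j → j ℕ.< s → B.rest x 0 j ≈ B′.rest x′ 0 j) where

    δ : Carrier
    δ = B.rest x 0 s - B′.rest x′ 0 s

    rest≈  : ∀ m j → m ℕ.+ j ℕ.< s → B.rest x m j ≈ B′.rest x′ m j
    power≈ : ∀ m → m ℕ.≤ s → B.power x m zero ≈ B′.power x′ m zero

    rest≈ zero    j j<s = rest≈₀ j j<s
    rest≈ (suc m) j m+j<s = begin
      B.rest x (suc m) j
        ≈⟨ B.rest-suc x m j ⟩
      B.power x m zero * B.returns j + B.rest x m (suc j)
        ≈⟨ +-cong (*-cong (power≈ m (ℕ.≤-trans (ℕ.m≤m+n m (suc j)) (ℕ.<⇒≤ m+1+j<s)))
                          (returns≈ j (ℕ.≤-<-trans (ℕ.m≤n+m j (suc m)) m+j<s)))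
                  (rest≈ m (suc j) m+1+j<s) ⟩
      B′.power x′ m zero * B′.returns j + B′.rest x′ m (suc j)
        ≈⟨ B′.rest-suc x′ m j ⟨
      B′.rest x′ (suc m) j ∎
      where
      m+1+j<s : m ℕ.+ suc j ℕ.< s
      m+1+j<s = ≡.subst (ℕ._< s) (≡.sym (ℕ.+-suc m j)) m+j<s

    power≈ zero    _ = x0≈x′0
    power≈ (suc m) m<s = trans (B.power-zero x m)
      (trans (rest≈ m 0 (≡.subst (ℕ._< s) (≡.sym (ℕ.+-identityʳ m)) m<s))
             (sym (B′.power-zero x′ m)))

    rest-difference : ∀ m j → m ℕ.+ j ≡ s → B.rest x m j ≈[ 1 × δ ] B′.rest x′ m j
    rest-difference zero    j ≡.refl = differ (sym (+-identityʳ δ))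
    rest-difference (suc m) j m+j≡s = difference-resp (B.rest-suc x m j) (B′.rest-suc x′ m j)
      (difference-+ (difference-zero (*-cong (power≈ m m≤s) (returns≈ j j<s)))
                    (rest-difference m (suc j) (≡.trans (ℕ.+-suc m j) m+j≡s)))
      where
      m≤s : m ℕ.≤ s
      m≤s = ≡.subst (m ℕ.≤_) m+j≡s (ℕ.≤-trans (ℕ.n≤1+n m) (ℕ.m≤m+n (suc m) j))
      j<s : j ℕ.< s
      j<s = ≡.subst (j ℕ.<_) m+j≡s (ℕ.s≤s (ℕ.m≤n+m j m))

    power-difference : B.power x (suc s) zero ≈[ 1 × δ ] B′.power x′ (suc s) zero
    power-difference = difference-resp (B.power-zero x s) (B′.power-zero x′ s)
      (rest-difference s 0 (ℕ.+-identityʳ s))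

  cancel-difference : ∀ {n x x′ y y′} → x ≈ x′ → x ≈[ suc n × (y - y′) ] x′ → y ≈ y′
  cancel-difference {n} {y = y} {y′} x≈x′ p = x∙y⁻¹≈ε⇒x≈y y y′
    (torsion-free n (y - y′) (trans (sym (difference p)) (difference (difference-zero {0#} x≈x′))))

  -- The returns of length s + 2 are the last to enter the closed walks of that
  -- length, once for each position at which the deleted vertex can lie.
  returns-determined : ∀ s → (∀ j → j ℕ.< s → B.returns j ≈ B′.returns j) →
    sumTuples (2 ℕ.+ s) (closedWalk G) ≈ sumTuples (2 ℕ.+ s) (closedWalk G′) →
    B.returns s ≈ B′.returns s
  returns-determined s returns≈ total≈ = begin
    B.returns s       ≈⟨ B.rest-column s ⟨
    B.rest (column B.M zero) 0 s      ≈⟨ cancel-difference total≈ total-difference ⟩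
    B′.rest (column B′.M zero) 0 s    ≈⟨ B′.rest-column s ⟩
    B′.returns s      ∎
    where
    open Start (column B.M zero) (column B′.M zero)
      (trans B.M-zero-zero (sym B′.M-zero-zero)) s returns≈
      (λ j j<s → trans (B.rest-column j) (trans (returns≈ j j<s) (sym (B′.rest-column j))))
    closedRest-difference : ∀ m j → m ℕ.+ j ≡ suc s → B.closedRest m j ≈[ m × δ ] B′.closedRest m j
    -- Only the closed walks inside the card are left, and these are common to both graphs.
    closedRest-difference zero    j _ = difference-zero (sum-cong-≋ λ i →
      ·-cong {x = fold (identityMatrix i) (B.A *ᵥ_) j} (λ _ → refl) (λ l →
        reflexive (≡.cong indicator (≡.trans (block l i) (≡.sym (block′ l i))))))
    closedRest-difference (suc m) j m+j≡s = difference-resp (B.closedRest-suc m j) (B′.closedRest-suc m j)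
      (difference-+ (rest-difference m j (ℕ.suc-injective m+j≡s))
                    (closedRest-difference m (suc j) (≡.trans (ℕ.+-suc m j) m+j≡s)))
    total-difference : sumTuples (2 ℕ.+ s) (closedWalk G) ≈[ 2 ℕ.+ s × δ ] sumTuples (2 ℕ.+ s) (closedWalk G′)
    total-difference = difference-resp (B.closedWalks≈ (suc s)) (B′.closedWalks≈ (suc s))
      (difference-+ power-difference (closedRest-difference (suc s) 0 (ℕ.+-identityʳ (suc s))))

  -- `departures s` enters twice: through the walks that start at `zero` and never come back, and
  -- through their reversals, which reach `zero` with the last step. A return within `s + 1` steps
  -- has index below `s`, so all other contributions agree already.
  departures-determined : ∀ s → (∀ j → j ℕ.< s → B.returns j ≈ B′.returns j) →
    (∀ j → j ℕ.< s → B.departures j ≈ B′.departures j) →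
    sumTuples (2 ℕ.+ s) (openWalk G) ≈ sumTuples (2 ℕ.+ s) (openWalk G′) →
    B.departures s ≈ B′.departures s
  departures-determined s returns≈ departures≈ total≈ = cancel-difference total≈ total-difference
    where
    open Start ones ones refl s returns≈ departures≈
    openRest-difference : ∀ m j → suc m ℕ.+ j ≡ suc s → B.openRest (suc m) j ≈[ 1 × δ ] B′.openRest (suc m) j
    openRest-difference zero j ≡.refl = difference-resp (B.openRest-suc zero j) (B′.openRest-suc zero j)
      (difference-+ {n = 0} (differ (trans (+-cong (*-identityˡ _) (-‿cong (*-identityˡ _))) (sym (+-identityʳ δ))))
                    (difference-zero refl))
    openRest-difference (suc m) j m+j≡s = difference-resp (B.openRest-suc (suc m) j) (B′.openRest-suc (suc m) j)
      (difference-+ (difference-zero (*-cong (power≈ (suc m) m≤s) (departures≈ j j<s)))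
                    (openRest-difference m (suc j) (≡.cong suc (≡.trans (ℕ.+-suc m j) m+j≡s′))))
      where
      m+j≡s′ : suc m ℕ.+ j ≡ s
      m+j≡s′ = ℕ.suc-injective m+j≡s
      m≤s : suc m ℕ.≤ s
      m≤s = ≡.subst (suc m ℕ.≤_) m+j≡s′ (ℕ.m≤m+n (suc m) j)
      j<s : j ℕ.< s
      j<s = ≡.subst (j ℕ.<_) m+j≡s′ (ℕ.s≤s (ℕ.m≤n+m j m))
    total-difference : sumTuples (2 ℕ.+ s) (openWalk G) ≈[ 2 × δ ] sumTuples (2 ℕ.+ s) (openWalk G′)
    total-difference = difference-resp (B.openWalks≈ (suc s)) (B′.openWalks≈ (suc s))
      (difference-+ power-difference (openRest-difference s 0 (≡.cong suc (ℕ.+-identityʳ s))))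

  module _ (bound : ℕ)
    (closed≈ : ∀ {s} → s ℕ.< bound → sumTuples (2 ℕ.+ s) (closedWalk G) ≈ sumTuples (2 ℕ.+ s) (closedWalk G′))
    (open≈   : ∀ {s} → s ℕ.< bound → sumTuples (2 ℕ.+ s) (openWalk G) ≈ sumTuples (2 ℕ.+ s) (openWalk G′))
    where

    returns≈ : ∀ s → s ℕ.< bound → B.returns s ≈ B′.returns s
    returns≈ = <-rec _ λ s ih s<bound → returns-determined s
      (λ _ j<s → ih j<s (ℕ.<-trans j<s s<bound)) (closed≈ s<bound)

    departures≈ : ∀ s → s ℕ.< bound → B.departures s ≈ B′.departures s
    departures≈ = <-rec _ λ s ih s<bound → departures-determined s
      (λ j j<s → returns≈ j (ℕ.<-trans j<s s<bound))
      (λ _ j<s → ih j<s (ℕ.<-trans j<s s<bound)) (open≈ s<bound)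

-- Reflections

module Reflection (R : CommutativeRing 0ℓ 0ℓ) {k}
  (ξ : Vector (CommutativeRing.Carrier R) k) (κ : CommutativeRing.Carrier R) where

  open CommutativeRing R hiding (zero)
  open LinearAlgebra (Semiring.rawSemiring semiring)
  open LinearAlgebraProperties R
  open WalkCounts R using (identity-·)
  open Algebra.Properties.Semiring.Sum semiring
  open Algebra.Properties.Ring ring
  open Relation.Binary.Reasoning.Setoid setoid
  open RingIdentities R
  open DifferenceSolver R using (solve; _:+_; _:*_; _:-_; :-_; _:=_)

  reflection : Matrix k k
  reflection i j = identityMatrix i j - κ * (ξ i * ξ j)

  reflection-· : ∀ i x → reflection i · x ≈ x i - κ * ((ξ · x) * ξ i)
  reflection-· i x = begin
    sum (λ j → (identityMatrix i j - κ * (ξ i * ξ j)) * x j)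
      ≈⟨ sum-cong-≋ (λ j → expand (identityMatrix i j) κ (ξ i) (ξ j) (x j)) ⟩
    sum (λ j → identityMatrix i j * x j + (- (κ * ξ i)) * (ξ j * x j))
      ≈⟨ ∑-distrib-+ (λ j → identityMatrix i j * x j) (λ j → (- (κ * ξ i)) * (ξ j * x j)) ⟩
    identityMatrix i · x + sum (λ j → (- (κ * ξ i)) * (ξ j * x j))
      ≈⟨ +-cong (identity-· i x) (sym (*-distribˡ-sum (- (κ * ξ i)) (λ j → ξ j * x j))) ⟩
    x i + (- (κ * ξ i)) * (ξ · x)
      ≈⟨ collect (x i) κ (ξ i) (ξ · x) ⟩
    x i - κ * ((ξ · x) * ξ i) ∎
    where
    expand : ∀ e κ a c x → (e - κ * (a * c)) * x ≈ e * x + (- (κ * a)) * (c * x)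
    expand = solve 5 (λ e κ a c x →
      (e :- κ :* (a :* c)) :* x := e :* x :+ (:- (κ :* a)) :* (c :* x)) refl
    collect : ∀ x κ a g → x + (- (κ * a)) * g ≈ x - κ * (g * a)
    collect = solve 4 (λ x κ a g → x :+ (:- (κ :* a)) :* g := x :- κ :* (g :* a)) refl

  identity-symmetric : ∀ {n} (i j : Fin n) → identityMatrix i j ≡ identityMatrix j i
  identity-symmetric i j = ≡.cong indicator
    (does-⇔ (mk⇔ ≡.sym ≡.sym) (i ≟ j) (j ≟ i))

  reflection-symmetric : Symmetric reflection
  reflection-symmetric i j = +-cong (reflexive (identity-symmetric i j))
    (-‿cong (*-congˡ (*-comm (ξ i) (ξ j))))

  -- If Aξ is a multiple of ξ, the reflection in ξ commutes with A.
  reflection-automorphism : (A : Matrix k k) → Symmetric A →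
    (∀ i l → ξ i * (A *ᵥ ξ) l ≈ ξ l * (A *ᵥ ξ) i) →
    (π : Permutation k k) → (∀ i j → reflection i j ≈ permutationMatrix π i j) →
    ∀ i j → A (π ⟨$⟩ʳ i) (π ⟨$⟩ʳ j) ≈ A i j
  reflection-automorphism A A-sym parallel π Q≈P i j = begin
    A (π ⟨$⟩ʳ i) p
      ≈⟨ identity-· (π ⟨$⟩ʳ i) (λ l → A l p) ⟨
    permutationMatrix π i · (λ l → A l p)
      ≈⟨ ·-cong (Q≈P i) (λ l → A-sym p l) ⟨
    reflection i · A p
      ≈⟨ reflection-· i (A p) ⟩
    A p i - κ * ((ξ · A p) * ξ i)
      ≈⟨ +-cong (A-sym p i) (-‿cong (*-congˡ (begin
           (ξ · A p) * ξ i     ≈⟨ *-comm (ξ · A p) (ξ i) ⟩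
           ξ i * (ξ · A p)     ≈⟨ *-congˡ (·-comm ξ (A p)) ⟩
           ξ i * (A *ᵥ ξ) p    ≈⟨ parallel i p ⟩
           ξ p * (A *ᵥ ξ) i    ≈⟨ *-congˡ (·-comm (A i) ξ) ⟩
           ξ p * (ξ · A i)     ≈⟨ *-comm (ξ p) (ξ · A i) ⟩
           (ξ · A i) * ξ p     ∎))) ⟩
    A i p - κ * ((ξ · A i) * ξ p)
      ≈⟨ reflection-· p (A i) ⟨
    reflection p · A i
      ≈⟨ ·-cong {x = reflection p} (λ l → trans (reflection-symmetric p l) (Q≈P l p)) (λ _ → refl) ⟩
    (λ l → permutationMatrix π l p) · A i
      ≈⟨ ·-cong {y = A i} (λ l → reflexive (≡.trans (injective l) (identity-symmetric l j))) (λ _ → refl) ⟩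
    identityMatrix j · A i
      ≈⟨ identity-· j (A i) ⟩
    A i j ∎
    where
    p : Fin k
    p = π ⟨$⟩ʳ j
    injective : ∀ l → permutationMatrix π l p ≡ identityMatrix l j
    injective l = ≡.cong indicator (does-⇔
      (mk⇔ (Injection.injective (↔⇒↣ π)) (≡.cong (π ⟨$⟩ʳ_))) (π ⟨$⟩ʳ l ≟ p) (l ≟ j))

  module Dichotomy (_≟0 : DecidableZero R) (noZeroDivisors : NoZeroDivisors R)
    (N≉0 : ¬ ξ · ξ ≈ 0#) (κN≈2 : κ * (ξ · ξ) ≈ 1# + 1#)
    (b b′ : Vector Carrier k)
    (parallel : ∀ i l → ξ i * (b′ l - b l) ≈ ξ l * (b′ i - b i))
    (norms : b′ · b′ ≈ b · b) where

    private
      N t g : Carrier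
      N = ξ · ξ
      g = ξ · b
      d u : Vector Carrier k
      d i = b′ i - b i
      u i = d i + (b i + b i)
      t = ξ · d

    -- Weighting the parallelism by `ξ l` and summing over `l` expresses `d` by `t` without having
    -- to single out a nonzero coordinate of `ξ`.
    scaled : ∀ i → N * d i ≈ ξ i * t
    scaled i = begin
      N * d i
        ≈⟨ *-distribʳ-sum (d i) (λ l → ξ l * ξ l) ⟩
      sum (λ l → ξ l * ξ l * d i)
        ≈⟨ sum-cong-≋ (λ l → trans (*-assoc (ξ l) (ξ l) (d i)) (*-congˡ (sym (parallel i l)))) ⟩
      ξ · (λ l → ξ i * d l)
        ≈⟨ ·-scaleʳ ξ (ξ i) d ⟩
      ξ i * t ∎

    -- `u` is `b′ + b`, so this is the difference of the two norms; writing it as `d + 2b` makes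
    -- `ξ · u` expand to `t + 2g`.
    d⊥u : d · u ≈ 0#
    d⊥u = begin
      d · u                       ≈⟨ [a+b]-b≈a (d · u) (b · b) ⟨
      (d · u + b · b) - b · b     ≈⟨ +-congʳ (trans (sym (∑-distrib-+ (λ i → d i * u i) (λ i → b i * b i)))
                                       (sum-cong-≋ (λ i → complete (b i) (b′ i)))) ⟩
      b′ · b′ - b · b             ≈⟨ +-congʳ norms ⟩
      b · b - b · b               ≈⟨ -‿inverseʳ (b · b) ⟩
      0#                          ∎
      where
      complete : ∀ x y → (y - x) * ((y - x) + (x + x)) + x * x ≈ y * y
      complete = solve 2 (λ x y → (y :- x) :* ((y :- x) :+ (x :+ x)) :+ x :* x := y :* y) refl

    -- With d parallel to ξ, the equation b′·b′ = b·b is quadratic in t.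
    quadratic : t * (t + (g + g)) ≈ 0#
    quadratic = begin
      t * (t + (g + g))
        ≈⟨ *-congˡ (trans (·-distribˡ ξ d (λ i → b i + b i)) (+-congˡ (·-distribˡ ξ b b))) ⟨
      t * (ξ · u)
        ≈⟨ ·-scaleʳ ξ t u ⟨
      ξ · (λ i → t * u i)
        ≈⟨ sum-cong-≋ (λ i → trans (sym (*-assoc (ξ i) t (u i)))
             (trans (*-congʳ (sym (scaled i))) (*-assoc N (d i) (u i)))) ⟩
      sum (λ i → N * (d i * u i))
        ≈⟨ *-distribˡ-sum N (λ i → d i * u i) ⟨
      N * (d · u)
        ≈⟨ trans (*-congˡ d⊥u) (zeroʳ N) ⟩
      0# ∎

    -- Where `t = −2g`, the identity `N d = t ξ` and `κ N = 2` give `N d = −N κ g ξ`; cancelling the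
    -- nonzero `N` leaves exactly the displacement of `b` under the reflection.
    reflected : t + (g + g) ≈ 0# → ∀ i → b′ i ≈ (reflection *ᵥ b) i
    reflected t+2g≈0 i = begin
      b′ i                                    ≈⟨ solution (b′ i) (b i) (κ * (g * ξ i)) ⟩
      (d i + κ * (g * ξ i)) + (b i - κ * (g * ξ i))  ≈⟨ +-congʳ (noZeroDivisors _ _ vanishes N≉0) ⟩
      0# + (b i - κ * (g * ξ i))              ≈⟨ +-identityˡ _ ⟩
      b i - κ * (g * ξ i)                     ≈⟨ reflection-· i b ⟨
      (reflection *ᵥ b) i                     ∎
      where
      solution : ∀ x y z → x ≈ ((x - y) + z) + (y - z)
      solution = solve 3 (λ x y z → x := ((x :- y) :+ z) :+ (y :- z)) refl
      expand : ∀ N d κ g x → N * (d + κ * (g * x)) ≈ N * d + (κ * N) * (g * x)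
      expand = solve 5 (λ N d κ g x → N :* (d :+ κ :* (g :* x)) := N :* d :+ (κ :* N) :* (g :* x)) refl
      vanishes : N * (d i + κ * (g * ξ i)) ≈ 0#
      vanishes = begin
        N * (d i + κ * (g * ξ i))             ≈⟨ expand N (d i) κ g (ξ i) ⟩
        N * d i + (κ * N) * (g * ξ i)         ≈⟨ +-cong (scaled i) (trans (*-congʳ κN≈2)
                                                   (trans (distribʳ (g * ξ i) 1# 1#)
                                                     (+-cong (*-identityˡ _) (*-identityˡ _)))) ⟩
        ξ i * t + (g * ξ i + g * ξ i)         ≈⟨ factor (ξ i) t g ⟩
        ξ i * (t + (g + g))                   ≈⟨ trans (*-congˡ t+2g≈0) (zeroʳ (ξ i)) ⟩
        0#                                    ∎
        where
        factor : ∀ x t g → x * t + (g * x + g * x) ≈ x * (t + (g + g))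
        factor = solve 3 (λ x t g → x :* t :+ (g :* x :+ g :* x) := x :* (t :+ (g :+ g))) refl

    reflection-dichotomy : (∀ i → b′ i ≈ b i) ⊎ (∀ i → b′ i ≈ (reflection *ᵥ b) i)
    reflection-dichotomy with t ≟0
    ... | yes t≈0 = inj₁ λ i → x∙y⁻¹≈ε⇒x≈y (b′ i) (b i)
      (noZeroDivisors _ _ (trans (scaled i) (trans (*-congˡ t≈0) (zeroʳ (ξ i)))) N≉0)
    ... | no t≉0  = inj₂ (reflected (noZeroDivisors _ _ quadratic t≉0))

open ≡ using (refl; sym; trans; cong; cong₂; subst; subst₂)

module ℚ-Ring = Algebra.Properties.Ring ℚ.+-*-ring
module ℚ-Sum = Algebra.Properties.Semiring.Sum (CommutativeRing.semiring ℚ.+-*-commutativeRing)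
module ℚ-Identities = RingIdentities ℚ.+-*-commutativeRing

-- Real numbers

half-positive : ∀ ε → .{{Positive ε}} → Positive (½ ℚ.* ε)
half-positive ε = ℚ.pos*pos⇒pos ½ ε

half+half : ∀ ε → ½ ℚ.* ε ℚ.+ ½ ℚ.* ε ≡ ε
half+half ε = trans (sym (ℚ.*-distribʳ-+ ε ½ ½)) (ℚ.*-identityˡ ε)

half< : ∀ ε → .(Positive ε) → ½ ℚ.* ε ℚ.< ε
half< ε ε>0 = begin-strict
  ½ ℚ.* ε               ≡⟨ ℚ.+-identityʳ (½ ℚ.* ε) ⟨
  ½ ℚ.* ε ℚ.+ 0ℚ        <⟨ ℚ.+-monoʳ-< (½ ℚ.* ε) (ℚ.positive⁻¹ (½ ℚ.* ε) {{half-positive ε {{ε>0}}}}) ⟩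
  ½ ℚ.* ε ℚ.+ ½ ℚ.* ε   ≡⟨ half+half ε ⟩
  ε                     ∎
  where open ℚ.≤-Reasoning

∣+∣≤ : ∀ {ε p q} → ℚ.∣ p ∣ ℚ.≤ ½ ℚ.* ε → ℚ.∣ q ∣ ℚ.≤ ½ ℚ.* ε →
       ℚ.∣ p ℚ.+ q ∣ ℚ.≤ ε
∣+∣≤ {ε} {p} {q} p≤ q≤ = ℚ.≤-trans (ℚ.∣p+q∣≤∣p∣+∣q∣ p q)
  (ℚ.≤-trans (ℚ.+-mono-≤ p≤ q≤) (ℚ.≤-reflexive (half+half ε)))

≃-pointwise : ∀ {x y} → (∀ n → seq x n ≡ seq y n) → x ≃ y
≃-pointwise {x} {y} eq ε {{ε>0}} = 0 , λ {n} _ →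
  subst (ℚ._≤ ε)
    (sym (cong ℚ.∣_∣ (trans (cong (ℚ._- seq y n) (eq n)) (ℚ.+-inverseʳ (seq y n)))))
    (ℚ.<⇒≤ (ℚ.positive⁻¹ ε {{ε>0}}))

≃-refl : ∀ {x} → x ≃ x
≃-refl {x} = ≃-pointwise {x} {x} (λ _ → refl)

≃-sym : ∀ {x y} → x ≃ y → y ≃ x
≃-sym {x} {y} x≃y ε {{ε>0}} =
  let N , close = x≃y ε {{ε>0}}
  in N , λ {n} n≥N → subst (ℚ._≤ ε)
    (trans (sym (ℚ.∣-p∣≡∣p∣ (seq x n ℚ.- seq y n)))
           (cong ℚ.∣_∣ (ℚ-Identities.-[a-b]≈b-a (seq x n) (seq y n))))
    (close n≥N)

private
  eventually-sum : ∀ {f g h : ℕ → ℚ} → (∀ n → f n ℚ.+ g n ≡ h n) →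
    (∀ ε → .{{Positive ε}} → ∃[ N ] ∀ {n} → N ℕ.≤ n → ℚ.∣ f n ∣ ℚ.≤ ε) →
    (∀ ε → .{{Positive ε}} → ∃[ N ] ∀ {n} → N ℕ.≤ n → ℚ.∣ g n ∣ ℚ.≤ ε) →
    (∀ ε → .{{Positive ε}} → ∃[ N ] ∀ {n} → N ℕ.≤ n → ℚ.∣ h n ∣ ℚ.≤ ε)
  eventually-sum eq f→0 g→0 ε {{ε>0}} =
    let M , f≤ = f→0 (½ ℚ.* ε) {{half-positive ε {{ε>0}}}}
        N , g≤ = g→0 (½ ℚ.* ε) {{half-positive ε {{ε>0}}}}
    in M ℕ.⊔ N , λ {n} n≥ → subst (λ d → ℚ.∣ d ∣ ℚ.≤ ε) (eq n)
      (∣+∣≤ (f≤ (ℕ.m⊔n≤o⇒m≤o M N n≥)) (g≤ (ℕ.m⊔n≤o⇒n≤o M N n≥)))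

≃-trans : ∀ {x y z} → x ≃ y → y ≃ z → x ≃ z
≃-trans {x} {y} {z} = eventually-sum
  (λ n → ℚ-Identities.telescope (seq x n) (seq y n) (seq z n))

+ℝ-cong : ∀ {x x′ y y′} → x ≃ x′ → y ≃ y′ → x +ℝ y ≃ x′ +ℝ y′
+ℝ-cong {x} {x′} {y} {y′} = eventually-sum
  (λ n → ℚ-Identities.interchange (seq x n) (seq x′ n) (seq y n) (seq y′ n))

eventually-≤ : ∀ x → Σ[ B ∈ ℚ ] Positive B × (∃[ N ] ∀ {n} → N ℕ.≤ n → ℚ.∣ seq x n ∣ ℚ.≤ B)
eventually-≤ x =
  let N , close = cauchy x 1ℚ
      a         = seq x N
  in 1ℚ ℚ.+ ℚ.∣ a ∣ , ℚ.pos+nonNeg⇒pos 1ℚ ℚ.∣ a ∣ {{ℚ.∣-∣-nonNeg a}} , N , λ {n} n≥N →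
     subst (λ d → ℚ.∣ d ∣ ℚ.≤ _) (ℚ-Identities.[a-b]+b≈a (seq x n) a)
       (ℚ.≤-trans (ℚ.∣p+q∣≤∣p∣+∣q∣ (seq x n ℚ.- a) a)
                  (ℚ.+-monoˡ-≤ ℚ.∣ a ∣ (close n≥N ℕ.≤-refl)))

positive-inverse : ∀ B → .(Positive B) → Σ[ C ∈ ℚ ] Positive C × C ℚ.* B ≡ 1ℚ
positive-inverse B B>0 =
  (ℚ.1/ B) {{B≢0}} , ℚ.1/pos⇒pos B {{B>0}} , ℚ.*-inverseˡ B {{B≢0}}
  where
  B≢0 : ℚ.NonZero B
  B≢0 = ℚ.pos⇒nonZero B {{B>0}}

∣*∣≤ : ∀ {p q a b} → ℚ.∣ p ∣ ℚ.≤ a → ℚ.∣ q ∣ ℚ.≤ b → .(Positive a) → ℚ.∣ p ℚ.* q ∣ ℚ.≤ a ℚ.* b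
∣*∣≤ {p} {q} {a} {b} p≤a q≤b a>0 =
  ℚ.≤-trans (ℚ.≤-reflexive (ℚ.∣p*q∣≡∣p∣*∣q∣ p q))
  (ℚ.≤-trans (ℚ.*-monoʳ-≤-nonNeg ℚ.∣ q ∣ {{ℚ.∣-∣-nonNeg q}} p≤a)
             (ℚ.*-monoˡ-≤-nonNeg a {{ℚ.pos⇒nonNeg a {{a>0}}}} q≤b))

*ℝ-congʳ : ∀ y {x x′} → x ≃ x′ → x *ℝ y ≃ x′ *ℝ y
*ℝ-congʳ y {x} {x′} x≃x′ ε {{ε>0}} =
  let B , B>0 , M , y≤B = eventually-≤ y
      C , C>0 , CB≡1    = positive-inverse B B>0
      εC>0              = ℚ.pos*pos⇒pos ε {{ε>0}} C {{C>0}}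
      N , close         = x≃x′ (ε ℚ.* C) {{εC>0}}
  in M ℕ.⊔ N , λ {n} n≥ →
    subst₂ (λ d e → ℚ.∣ d ∣ ℚ.≤ e)
      (sym (ℚ-Identities.ac-bc≈[a-b]c (seq x n) (seq x′ n) (seq y n)))
      (trans (ℚ.*-assoc ε C B) (trans (cong (ε ℚ.*_) CB≡1) (ℚ.*-identityʳ ε)))
      (∣*∣≤ (close (ℕ.m⊔n≤o⇒n≤o M N n≥)) (y≤B (ℕ.m⊔n≤o⇒m≤o M N n≥)) εC>0)

*ℝ-comm : ∀ x y → x *ℝ y ≃ y *ℝ x
*ℝ-comm x y = ≃-pointwise {x *ℝ y} {y *ℝ x} (λ n → ℚ.*-comm (seq x n) (seq y n))

*ℝ-cong : ∀ {x x′ y y′} → x ≃ x′ → y ≃ y′ → x *ℝ y ≃ x′ *ℝ y′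
*ℝ-cong {x} {x′} {y} {y′} x≃x′ y≃y′ =
  ≃-trans {x *ℝ y} {x′ *ℝ y} {x′ *ℝ y′} (*ℝ-congʳ y {x} {x′} x≃x′)
  (≃-trans {x′ *ℝ y} {y *ℝ x′} {x′ *ℝ y′} (*ℝ-comm x′ y)
  (≃-trans {y *ℝ x′} {y′ *ℝ x′} {x′ *ℝ y′} (*ℝ-congʳ x′ {y} {y′} y≃y′) (*ℝ-comm y′ x′)))

0ℝ 1ℝ -1ℝ : ℝ
0ℝ  = fromℚ 0ℚ
1ℝ  = fromℚ 1ℚ
-1ℝ = fromℚ (ℚ.- 1ℚ)

ℝ-commutativeRing : CommutativeRing 0ℓ 0ℓ
ℝ-commutativeRing = record
  { Carrier = ℝ
  ; _≈_ = _≃_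
  ; _+_ = _+ℝ_
  ; _*_ = _*ℝ_
  -- Negation as a product inherits its modulus of convergence and its congruence from
  -- multiplication.
  ; -_  = -1ℝ *ℝ_
  ; 0#  = 0ℝ
  ; 1#  = 1ℝ
  ; isCommutativeRing = record
    { isRing = record
      { +-isAbelianGroup = record
        { isGroup = record
          { isMonoid = record
            { isSemigroup = record
              { isMagma = record
                { isEquivalence = record
                  { refl  = λ {x} → ≃-refl {x}
                  ; sym   = λ {x} {y} → ≃-sym {x} {y}
                  ; trans = λ {x} {y} {z} → ≃-trans {x} {y} {z}
                  }
                ; ∙-cong = λ {x} {x′} {y} {y′} → +ℝ-cong {x} {x′} {y} {y′}
                }
              ; assoc = λ x y z → ≃-pointwise {(x +ℝ y) +ℝ z} {x +ℝ (y +ℝ z)}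
                  (λ n → ℚ.+-assoc (seq x n) (seq y n) (seq z n))
              }
            ; identity = (λ x → ≃-pointwise {0ℝ +ℝ x} {x} (λ n → ℚ.+-identityˡ (seq x n)))
                       , (λ x → ≃-pointwise {x +ℝ 0ℝ} {x} (λ n → ℚ.+-identityʳ (seq x n)))
            }
          ; inverse = (λ x → ≃-pointwise {(-1ℝ *ℝ x) +ℝ x} {0ℝ} (λ n → inverseˡ (seq x n)))
                    , (λ x → ≃-pointwise {x +ℝ (-1ℝ *ℝ x)} {0ℝ}
                        (λ n → trans (ℚ.+-comm (seq x n) _) (inverseˡ (seq x n))))
          ; ⁻¹-cong = λ {x} {y} → *ℝ-cong { -1ℝ} { -1ℝ} {x} {y} (≃-refl { -1ℝ})
          }
        ; comm = λ x y → ≃-pointwise {x +ℝ y} {y +ℝ x} (λ n → ℚ.+-comm (seq x n) (seq y n))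
        }
      ; *-cong = λ {x} {x′} {y} {y′} → *ℝ-cong {x} {x′} {y} {y′}
      ; *-assoc = λ x y z → ≃-pointwise {(x *ℝ y) *ℝ z} {x *ℝ (y *ℝ z)}
          (λ n → ℚ.*-assoc (seq x n) (seq y n) (seq z n))
      ; *-identity = (λ x → ≃-pointwise {1ℝ *ℝ x} {x} (λ n → ℚ.*-identityˡ (seq x n)))
                   , (λ x → ≃-pointwise {x *ℝ 1ℝ} {x} (λ n → ℚ.*-identityʳ (seq x n)))
      ; distrib = (λ x y z → ≃-pointwise {x *ℝ (y +ℝ z)} {(x *ℝ y) +ℝ (x *ℝ z)}
                    (λ n → ℚ.*-distribˡ-+ (seq x n) (seq y n) (seq z n)))
                , (λ x y z → ≃-pointwise {(y +ℝ z) *ℝ x} {(y *ℝ x) +ℝ (z *ℝ x)}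
                    (λ n → ℚ.*-distribʳ-+ (seq x n) (seq y n) (seq z n)))
      }
    ; *-comm = *ℝ-comm
    }
  }
  where
  inverseˡ : ∀ a → ℚ.- 1ℚ ℚ.* a ℚ.+ a ≡ 0ℚ
  inverseˡ a = trans (cong (ℚ._+ a) (ℚ-Ring.-1*x≈-x a)) (ℚ.+-inverseˡ a)

-- If x fails to be null at precision ε, then it stays away from zero.
≃0-by-contradiction : ∀ x →
  (∀ δ → .(Positive δ) → ∀ N → ¬ (∀ {n} → N ℕ.≤ n → δ ℚ.≤ ℚ.∣ seq x n ∣)) → x ≃ 0ℝ
≃0-by-contradiction x not-apart ε {{ε>0}} = N , small
  where
  N = proj₁ (cauchy x (½ ℚ.* ε) {{half-positive ε {{ε>0}}}})
  close = proj₂ (cauchy x (½ ℚ.* ε) {{half-positive ε {{ε>0}}}})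
  open ℚ.≤-Reasoning
  small : ∀ {n} → N ℕ.≤ n → ℚ.∣ seq x n ℚ.- 0ℚ ∣ ℚ.≤ ε
  small {n} n≥N with ℚ.∣ seq x n ℚ.- 0ℚ ∣ ℚ.≤? ε
  ... | yes p = p
  ... | no ¬p = ⊥-elim (not-apart (½ ℚ.* ε) (half-positive ε {{ε>0}}) N far)
    where
    far : ∀ {m} → N ℕ.≤ m → ½ ℚ.* ε ℚ.≤ ℚ.∣ seq x m ∣
    far {m} m≥N with ½ ℚ.* ε ℚ.≤? ℚ.∣ seq x m ∣
    ... | yes q = q
    ... | no ¬q = contradiction (begin
      ℚ.∣ seq x n ℚ.- 0ℚ ∣                      ≡⟨ cong ℚ.∣_∣ (ℚ.+-identityʳ (seq x n)) ⟩
      ℚ.∣ seq x n ∣                             ≡⟨ cong ℚ.∣_∣ (ℚ-Identities.[a-b]+b≈a (seq x n) (seq x m)) ⟨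
      ℚ.∣ (seq x n ℚ.- seq x m) ℚ.+ seq x m ∣   ≤⟨ ∣+∣≤ (close n≥N m≥N) (ℚ.<⇒≤ (ℚ.≰⇒> ¬q)) ⟩
      ε                                         ∎) ¬p

-- The goal inside is a contradiction, so the doubly negated `x ≃ 0ℝ` may be used as if it were
-- given, and it conflicts with `x` staying away from zero.
≃0-stable : ∀ x → ¬ ¬ (x ≃ 0ℝ) → x ≃ 0ℝ
≃0-stable x ¬¬x≃0 = ≃0-by-contradiction x λ δ δ>0 N far → ¬¬x≃0 λ x≃0 →
  let M , small = x≃0 (½ ℚ.* δ) {{half-positive δ {{δ>0}}}}
  in ℚ.<-irrefl refl (begin-strict
    ½ ℚ.* δ               <⟨ half< δ δ>0 ⟩
    δ                     ≤⟨ far (ℕ.m≤n⊔m M N) ⟩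
    ℚ.∣ seq x (M ℕ.⊔ N) ∣ ≡⟨ cong ℚ.∣_∣ (ℚ.+-identityʳ (seq x (M ℕ.⊔ N))) ⟨
    ℚ.∣ seq x (M ℕ.⊔ N) ℚ.- 0ℚ ∣ ≤⟨ small (ℕ.m≤m⊔n M N) ⟩
    ½ ℚ.* δ               ∎)
  where
  open ℚ.≤-Reasoning

fromℚ-injective : ∀ {q} → fromℚ q ≃ 0ℝ → q ≡ 0ℚ
fromℚ-injective {q} q≃0 with q ℚ.≟ 0ℚ
... | yes p = p
... | no q≢0 = ⊥-elim (ℚ.<-irrefl refl (begin-strict
    ½ ℚ.* ℚ.∣ q ∣     <⟨ half< ℚ.∣ q ∣ ∣q∣>0 ⟩
    ℚ.∣ q ∣           ≡⟨ cong ℚ.∣_∣ (ℚ.+-identityʳ q) ⟨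
    ℚ.∣ q ℚ.- 0ℚ ∣    ≤⟨ proj₂ (q≃0 (½ ℚ.* ℚ.∣ q ∣) {{half-positive ℚ.∣ q ∣ {{∣q∣>0}}}}) ℕ.≤-refl ⟩
    ½ ℚ.* ℚ.∣ q ∣     ∎))
  where
  open ℚ.≤-Reasoning
  ∣q∣>0 : Positive ℚ.∣ q ∣
  ∣q∣>0 = ℚ.nonNeg∧nonZero⇒pos ℚ.∣ q ∣ {{ℚ.∣-∣-nonNeg q}}
    {{ℚ.≢-nonZero (λ ∣q∣≡0 → q≢0 (ℚ.∣p∣≡0⇒p≡0 q ∣q∣≡0))}}

-- If `y` stayed at distance `δ` from zero, precision `ε * δ` for the product would give precision
-- `ε` for `x`, making `x` null.
ℝ-noZeroDivisors : NoZeroDivisors ℝ-commutativeRing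
ℝ-noZeroDivisors x y xy≃0 x≄0 = ≃0-by-contradiction y λ δ δ>0 N far →
  x≄0 λ ε {{ε>0}} →
  let M , small = xy≃0 (ε ℚ.* δ) {{ℚ.pos*pos⇒pos ε {{ε>0}} δ {{δ>0}}}}
  in M ℕ.⊔ N , λ {n} n≥ → ℚ.*-cancelʳ-≤-pos δ {{δ>0}} (begin
    ℚ.∣ seq x n ℚ.- 0ℚ ∣ ℚ.* δ             ≡⟨ cong (λ a → ℚ.∣ a ∣ ℚ.* δ) (ℚ.+-identityʳ (seq x n)) ⟩
    ℚ.∣ seq x n ∣ ℚ.* δ                    ≤⟨ ℚ.*-monoˡ-≤-nonNeg ℚ.∣ seq x n ∣ {{ℚ.∣-∣-nonNeg (seq x n)}} (far (ℕ.m⊔n≤o⇒n≤o M N n≥)) ⟩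
    ℚ.∣ seq x n ∣ ℚ.* ℚ.∣ seq y n ∣        ≡⟨ ℚ.∣p*q∣≡∣p∣*∣q∣ (seq x n) (seq y n) ⟨
    ℚ.∣ seq x n ℚ.* seq y n ∣              ≡⟨ cong ℚ.∣_∣ (ℚ.+-identityʳ (seq x n ℚ.* seq y n)) ⟨
    ℚ.∣ seq x n ℚ.* seq y n ℚ.- 0ℚ ∣       ≤⟨ small (ℕ.m⊔n≤o⇒m≤o M N n≥) ⟩
    ε ℚ.* δ                                ∎)
  where open ℚ.≤-Reasoning

-- Rational numbers and the embedding of the integers

ℚ-noZeroDivisors : NoZeroDivisors ℚ.+-*-commutativeRing
ℚ-noZeroDivisors p q pq≡0 p≢0 = begin
  q                   ≡⟨ ℚ.*-identityˡ q ⟨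
  1ℚ ℚ.* q            ≡⟨ cong (ℚ._* q) (ℚ.*-inverseˡ p) ⟨
  ℚ.1/ p ℚ.* p ℚ.* q  ≡⟨ ℚ.*-assoc (ℚ.1/ p) p q ⟩
  ℚ.1/ p ℚ.* (p ℚ.* q) ≡⟨ cong (ℚ.1/ p ℚ.*_) pq≡0 ⟩
  ℚ.1/ p ℚ.* 0ℚ       ≡⟨ ℚ.*-zeroʳ (ℚ.1/ p) ⟩
  0ℚ                  ∎
  where
  open ≡.≡-Reasoning
  instance p-nonZero = ℚ.≢-nonZero p≢0

square-nonNegative : ∀ p → 0ℚ ℚ.≤ p ℚ.* p
square-nonNegative p with ℚ.≤-total 0ℚ p
... | inj₁ 0≤p = ℚ.nonNegative⁻¹ _ {{ℚ.nonNeg*nonNeg⇒nonNeg p {{ℚ.nonNegative 0≤p}} p {{ℚ.nonNegative 0≤p}}}}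
... | inj₂ p≤0 = ℚ.nonNegative⁻¹ _ {{ℚ.nonPos*nonPos⇒nonPos p {{ℚ.nonPositive p≤0}} p {{ℚ.nonPositive p≤0}}}}

sum-nonNegative : ∀ {n} {f : Vector ℚ n} → (∀ i → 0ℚ ℚ.≤ f i) → 0ℚ ℚ.≤ ℚ-Sum.sum f
sum-nonNegative {zero}  f≥0 = ℚ.≤-refl
sum-nonNegative {suc n} f≥0 = ℚ.≤-trans (ℚ.≤-reflexive (sym (ℚ.+-identityˡ 0ℚ)))
  (ℚ.+-mono-≤ (f≥0 zero) (sum-nonNegative (f≥0 ∘ suc)))

term≤sum : ∀ {n} {f : Vector ℚ n} → (∀ i → 0ℚ ℚ.≤ f i) → ∀ i → f i ℚ.≤ ℚ-Sum.sum f
term≤sum {suc n} {f} f≥0 i = begin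
  f i                              ≡⟨ ℚ.+-identityʳ (f i) ⟨
  f i ℚ.+ 0ℚ                       ≤⟨ ℚ.+-monoʳ-≤ (f i) (sum-nonNegative (f≥0 ∘ punchIn i)) ⟩
  f i ℚ.+ ℚ-Sum.sum (f ∘ punchIn i)      ≡⟨ ℚ-Sum.sum-remove {i = i} f ⟨
  ℚ-Sum.sum f                          ∎
  where open ℚ.≤-Reasoning

·-definite : ∀ {n} (x : Vector ℚ n) → x Linℚ.· x ≡ 0ℚ → ∀ i → x i ≡ 0ℚ
·-definite x x·x≡0 i with x i ℚ.≟ 0ℚ
... | yes p = p
... | no ¬p = ℚ-noZeroDivisors (x i) (x i) (ℚ.≤-antisym
  (ℚ.≤-trans (term≤sum (λ i → square-nonNegative (x i)) i) (ℚ.≤-reflexive x·x≡0))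
  (square-nonNegative (x i))) ¬p

module ℚ-Linear = LinearAlgebraProperties ℚ.+-*-commutativeRing

module ℚ-Dependence = LinearDependence ℚ.+-*-commutativeRing (ℚ._≟ 0ℚ) ℚ.1≢0 ℚ-noZeroDivisors
open ℚ-Dependence using (Dependent)

fromℤ : ℤ → ℚ
fromℤ z = z ℚ./ 1

toℚᵘ-fromℤ : ∀ z → ℚ.toℚᵘ (fromℤ z) ℚᵘ.≃ mkℚᵘ z 0
toℚᵘ-fromℤ z = ℚ.toℚᵘ-fromℚᵘ (mkℚᵘ z 0)

fromℤ-+ : ∀ y z → fromℤ (y ℤ.+ z) ≡ fromℤ y ℚ.+ fromℤ z
fromℤ-+ y z = ℚ.toℚᵘ-injective (begin
  ℚ.toℚᵘ (fromℤ (y ℤ.+ z))                   ≈⟨ toℚᵘ-fromℤ (y ℤ.+ z) ⟩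
  mkℚᵘ (y ℤ.+ z) 0                           ≈⟨ *≡* (cong (ℤ._* + 1) (sym (cong₂ ℤ._+_ (ℤ.*-identityʳ y) (ℤ.*-identityʳ z)))) ⟩
  mkℚᵘ y 0 ℚᵘ.+ mkℚᵘ z 0                     ≈⟨ ℚᵘ.+-cong (toℚᵘ-fromℤ y) (toℚᵘ-fromℤ z) ⟨
  ℚ.toℚᵘ (fromℤ y) ℚᵘ.+ ℚ.toℚᵘ (fromℤ z)     ≈⟨ ℚ.toℚᵘ-homo-+ (fromℤ y) (fromℤ z) ⟨
  ℚ.toℚᵘ (fromℤ y ℚ.+ fromℤ z)               ∎)
  where open Relation.Binary.Reasoning.Setoid ℚᵘ.≃-setoid

fromℤ-* : ∀ y z → fromℤ (y ℤ.* z) ≡ fromℤ y ℚ.* fromℤ z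
fromℤ-* y z = ℚ.toℚᵘ-injective (begin
  ℚ.toℚᵘ (fromℤ (y ℤ.* z))                   ≈⟨ toℚᵘ-fromℤ (y ℤ.* z) ⟩
  mkℚᵘ y 0 ℚᵘ.* mkℚᵘ z 0                     ≈⟨ ℚᵘ.*-cong (toℚᵘ-fromℤ y) (toℚᵘ-fromℤ z) ⟨
  ℚ.toℚᵘ (fromℤ y) ℚᵘ.* ℚ.toℚᵘ (fromℤ z)     ≈⟨ ℚ.toℚᵘ-homo-* (fromℤ y) (fromℤ z) ⟨
  ℚ.toℚᵘ (fromℤ y ℚ.* fromℤ z)               ∎)
  where open Relation.Binary.Reasoning.Setoid ℚᵘ.≃-setoid

/-*-cancel : ∀ z n .{{_ : ℕ.NonZero n}} → (z ℚ./ n) ℚ.* fromℤ (+ n) ≡ fromℤ z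
/-*-cancel z (suc n) = ℚ.toℚᵘ-injective (begin
  ℚ.toℚᵘ ((z ℚ./ suc n) ℚ.* fromℤ (+ suc n))             ≈⟨ ℚ.toℚᵘ-homo-* (z ℚ./ suc n) (fromℤ (+ suc n)) ⟩
  ℚ.toℚᵘ (z ℚ./ suc n) ℚᵘ.* ℚ.toℚᵘ (fromℤ (+ suc n))     ≈⟨ ℚᵘ.*-cong (ℚ.toℚᵘ-fromℚᵘ (mkℚᵘ z n)) (toℚᵘ-fromℤ (+ suc n)) ⟩
  mkℚᵘ z n ℚᵘ.* mkℚᵘ (+ suc n) 0                         ≈⟨ *≡* (trans (ℤ.*-identityʳ _) (cong (z ℤ.*_) (cong +_ (sym (ℕ.*-identityʳ (suc n)))))) ⟩
  mkℚᵘ z 0                                               ≈⟨ toℚᵘ-fromℤ z ⟨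
  ℚ.toℚᵘ (fromℤ z)                                       ∎)
  where open Relation.Binary.Reasoning.Setoid ℚᵘ.≃-setoid

fromℤ-injective : ∀ {z} → fromℤ z ≡ 0ℚ → z ≡ 0ℤ
fromℤ-injective {z} eq with ℚ.fromℚᵘ-injective {mkℚᵘ z 0} {mkℚᵘ 0ℤ 0} eq
... | *≡* z*1≡0 = trans (sym (ℤ.*-identityʳ z)) z*1≡0

fromℤ-preserves : Preserves ℤ.+-*-rawSemiring ℚ.+-*-commutativeRing fromℤ
fromℤ-preserves = record { h-+ = fromℤ-+ ; h-* = fromℤ-* ; h-0 = refl ; h-1 = refl }

-- Main eigenvalues and the independence of the walk vectors

open Walks ℚ.+-*-rawSemiring using (walks)

fromℤ-walks : ∀ {k} (F : Graph k) m i → fromℤ (Walks.walks ℤ.+-*-rawSemiring F m i) ≡ walks F m i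
fromℤ-walks = WalkHomomorphism.homo-walks ℤ.+-*-rawSemiring ℚ.+-*-commutativeRing fromℤ fromℤ-preserves

record ℝ-Embedding (S : CommutativeRing 0ℓ 0ℓ) : Set where
  open CommutativeRing S using (Carrier; _≈_; 0#)
  field
    h           : ℝ → Carrier
    h-cong      : ∀ {x y} → x ≃ y → h x ≈ h y
    h-injective : ∀ {x y} → h x ≈ h y → x ≃ y
    h-preserves : Preserves +-*-rawSemiringℝ S h
    ι           : ℚ → Carrier
    ι-injective : ∀ {q} → ι q ≈ 0# → q ≡ 0ℚ
    ι-preserves : Preserves ℚ.+-*-rawSemiring S ι
    stable      : ∀ {x} → ¬ ¬ x ≈ 0# → x ≈ 0#

-- The reals enter only through the abstract ring S: comparing expressions in ℝ
-- itself would unfold their moduli of convergence.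
module MainEigenvalues (S : CommutativeRing 0ℓ 0ℓ) (noZeroDivisors : NoZeroDivisors S)
  (embedding : ℝ-Embedding S) {k} (F : Graph k) where

  open CommutativeRing S hiding (zero; refl; sym; trans)
  open ℝ-Embedding embedding
  private
    module Sᶜ = CommutativeRing S
    module LS = LinearAlgebra (Semiring.rawSemiring semiring)
    module WS = Walks (Semiring.rawSemiring semiring) F
    module hᴴ = WalkHomomorphism +-*-rawSemiringℝ S h h-preserves
    open Preserves h-preserves using (h-*; h-0)
    module ιᴴ = WalkHomomorphism ℚ.+-*-rawSemiring S ι ι-preserves
  open LinearAlgebraProperties S
  open Polynomials S noZeroDivisors using (eval; too-many-roots)
  open WalkPolynomials S noZeroDivisors F
  open Relation.Binary.Reasoning.Setoid setoid

  h-eigenvector : ∀ {μ v} → InEigenspace F μ v →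
                  ∀ i → (LS.adjacencyMatrix F LS.*ᵥ (h ∘ v)) i ≈ h μ * h (v i)
  h-eigenvector {μ} {v} Av≃μv i = begin
    (LS.adjacencyMatrix F LS.*ᵥ (h ∘ v)) i
      ≈⟨ hᴴ.homo-adjacency F v i ⟨
    h (LinearAlgebra._*ᵥ_ +-*-rawSemiringℝ (LinearAlgebra.adjacencyMatrix +-*-rawSemiringℝ F) v i)
      ≈⟨ h-cong {LinearAlgebra._*ᵥ_ +-*-rawSemiringℝ (LinearAlgebra.adjacencyMatrix +-*-rawSemiringℝ F) v i}
                {μ *ℝ v i} (Av≃μv i) ⟩
    h (μ *ℝ v i)
      ≈⟨ h-* μ (v i) ⟩
    h μ * h (v i) ∎

  -- No eigenvector is ever chosen: if the value at `μ` were nonzero, cancelling it would make every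
  -- eigenvector for `μ` orthogonal to `ones`, against `μ` being main. Stability turns this
  -- refutation into an equation.
  main-eigenvalue-root : ∀ {r} (c : Vector ℚ r) → (∀ i → c Linℚ.· (λ j → walks F (toℕ j) i) ≡ 0ℚ) →
                         ∀ {μ} → IsMainEigenvalue F μ → eval (ι ∘ c) (h μ) ≈ 0#
  main-eigenvalue-root c relation {μ} (_ , main) = stable λ p≉0 → main λ v Av≃μv →
    h-injective {LinearAlgebra._·_ +-*-rawSemiringℝ (LinearAlgebra.ones +-*-rawSemiringℝ) v} {fromℚ 0ℚ} (begin
      h (LinearAlgebra._·_ +-*-rawSemiringℝ (LinearAlgebra.ones +-*-rawSemiringℝ) v)
        ≈⟨ hᴴ.homo-ones v ⟩
      LS.ones LS.· (h ∘ v)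
        ≈⟨ noZeroDivisors _ _ (eval-annihilates (ι ∘ c) ι-relation (h-eigenvector {μ} {v} Av≃μv)) p≉0 ⟩
      0#
        ≈⟨ h-0 ⟨
      h (fromℚ 0ℚ) ∎)
    where
    ι-relation : ∀ i → (ι ∘ c) LS.· (λ j → WS.walks (toℕ j) i) ≈ 0#
    ι-relation i = begin
      (ι ∘ c) LS.· (λ j → WS.walks (toℕ j) i)
        ≈⟨ ·-cong {x = ι ∘ c} (λ _ → Sᶜ.refl) (λ j → ιᴴ.homo-walks F (toℕ j) i) ⟨
      (ι ∘ c) LS.· (λ j → ι (walks F (toℕ j) i))
        ≈⟨ ιᴴ.homo-· c (λ j → walks F (toℕ j) i) ⟨
      ι (c Linℚ.· (λ j → walks F (toℕ j) i))
        ≈⟨ reflexive (cong ι (relation i)) ⟩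
      ι 0ℚ
        ≈⟨ Preserves.h-0 ι-preserves ⟩
      0# ∎

  -- A dependency is a rational polynomial with `pred k` coefficients, and the listed main
  -- eigenvalues are `pred k` distinct real roots of it.
  independent : AlmostControllable F → ¬ Dependent {pred k} (λ j → walks F (toℕ j))
  independent (μ , main , distinct , _) (c , c≢0 , relation) = c≢0 λ j →
    ι-injective (too-many-roots (ι ∘ c) (h ∘ μ) (λ i j eq → distinct i j (h-injective eq))
      (λ i → main-eigenvalue-root c relation (main i)) j)

ℝ-embedding : ℝ-Embedding ℝ-commutativeRing
ℝ-embedding = record
  { h           = λ x → x
  ; h-cong      = λ x≃y → x≃y
  ; h-injective = λ x≃y → x≃y
  ; h-preserves = record
    { h-+ = λ x y → ≃-refl {x +ℝ y}
    ; h-* = λ x y → ≃-refl {x *ℝ y}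
    ; h-0 = ≃-refl {0ℝ}
    ; h-1 = ≃-refl {1ℝ}
    }
  ; ι           = fromℚ
  ; ι-injective = fromℚ-injective
  ; ι-preserves = record
    { h-+ = λ p q → ≃-pointwise {fromℚ (p ℚ.+ q)} {fromℚ p +ℝ fromℚ q} (λ _ → refl)
    ; h-* = λ p q → ≃-pointwise {fromℚ (p ℚ.* q)} {fromℚ p *ℝ fromℚ q} (λ _ → refl)
    ; h-0 = ≃-refl {0ℝ}
    ; h-1 = ≃-refl {1ℝ}
    }
  ; stable      = λ {x} → ≃0-stable x
  }

walks-independent : ∀ {k} (F : Graph k) → AlmostControllable F → ¬ Dependent {pred k} (λ j → walks F (toℕ j))
walks-independent = MainEigenvalues.independent ℝ-commutativeRing ℝ-noZeroDivisors ℝ-embedding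

open Algebra.Properties.Semiring.Mult (CommutativeRing.semiring ℚ.+-*-commutativeRing)
  using () renaming (_×_ to _×ℚ_)

×ℚ≡fromℤ* : ∀ n x → n ×ℚ x ≡ fromℤ (+ n) ℚ.* x
×ℚ≡fromℤ* zero    x = sym (ℚ.*-zeroˡ x)
×ℚ≡fromℤ* (suc n) x = trans
  (cong₂ ℚ._+_ (sym (ℚ.*-identityˡ x)) (×ℚ≡fromℤ* n x))
  (trans (sym (ℚ.*-distribʳ-+ x (fromℤ 1ℤ) (fromℤ (+ n))))
         (cong (ℚ._* x) (sym (fromℤ-+ 1ℤ (+ n)))))

1/suc : ℕ → ℚ
1/suc n = 1ℤ ℚ./ suc n

1/suc-inverse : ∀ n → suc n ×ℚ 1/suc n ≡ 1ℚ
1/suc-inverse n = trans (×ℚ≡fromℤ* (suc n) (1/suc n))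
  (trans (ℚ.*-comm (fromℤ (+ suc n)) (1/suc n)) (/-*-cancel 1ℤ (suc n)))

ℚ-torsion-free : ∀ n x → suc n ×ℚ x ≡ 0ℚ → x ≡ 0ℚ
ℚ-torsion-free n x eq = ℚ-noZeroDivisors (fromℤ (+ suc n)) x
  (trans (sym (×ℚ≡fromℤ* (suc n) x)) eq)
  (λ n≡0 → contradiction (fromℤ-injective {+ suc n} n≡0) λ ())

/-fromℤ : ∀ y z n .{{_ : ℕ.NonZero n}} → (y ℤ.* z) ℚ./ n ≡ (y ℚ./ n) ℚ.* fromℤ z
/-fromℤ y z (suc n) = ℚ.toℚᵘ-injective (begin
  ℚ.toℚᵘ ((y ℤ.* z) ℚ./ suc n)                ≈⟨ ℚ.toℚᵘ-fromℚᵘ (mkℚᵘ (y ℤ.* z) n) ⟩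
  mkℚᵘ (y ℤ.* z) n                            ≈⟨ *≡* (cong (y ℤ.* z ℤ.*_) (cong +_ (ℕ.*-identityʳ (suc n)))) ⟩
  mkℚᵘ y n ℚᵘ.* mkℚᵘ z 0                      ≈⟨ ℚᵘ.*-cong (ℚ.toℚᵘ-fromℚᵘ (mkℚᵘ y n)) (toℚᵘ-fromℤ z) ⟨
  ℚ.toℚᵘ (y ℚ./ suc n) ℚᵘ.* ℚ.toℚᵘ (fromℤ z)  ≈⟨ ℚ.toℚᵘ-homo-* (y ℚ./ suc n) (fromℤ z) ⟨
  ℚ.toℚᵘ ((y ℚ./ suc n) ℚ.* fromℤ z)          ∎)
  where open Relation.Binary.Reasoning.Setoid ℚᵘ.≃-setoid

fromℤ-· : ∀ {n} (x y : Vector ℤ n) → fromℤ (x Linℤ.· y) ≡ (fromℤ ∘ x) Linℚ.· (fromℤ ∘ y)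
fromℤ-· = WalkHomomorphism.homo-· ℤ.+-*-rawSemiring ℚ.+-*-commutativeRing fromℤ fromℤ-preserves

∣x·x∣≡x·x : ∀ {n} (x : Vector ℤ n) → + ℤ.∣ x Linℤ.· x ∣ ≡ x Linℤ.· x
∣x·x∣≡x·x x = ℤ.0≤i⇒+∣i∣≡i (nonNegative x)
  where
  square≥0 : ∀ i → 0ℤ ℤ.≤ i ℤ.* i
  square≥0 (+ n)    = subst (0ℤ ℤ.≤_) (ℤ.pos-* n n) (ℤ.+≤+ ℕ.z≤n)
  square≥0 -[1+ n ] = ℤ.+≤+ ℕ.z≤n
  nonNegative : ∀ {n} (x : Vector ℤ n) → 0ℤ ℤ.≤ x Linℤ.· x
  nonNegative {zero}  x = ℤ.≤-refl
  nonNegative {suc n} x = ℤ.+-mono-≤ (square≥0 (x zero)) (nonNegative (x ∘ suc))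

indicator-injective : ∀ {x y} → Linℚ.indicator x ≡ Linℚ.indicator y → x ≡ y
indicator-injective {true}  {true}  _ = refl
indicator-injective {false} {false} _ = refl

-- The normal vector and its reflection in an almost controllable graph

module _ {k} {F : Graph (suc k)} (w : WalkNormal F) where
  open WalkNormal w

  ξℚ : Vector ℚ (suc k)
  ξℚ = fromℤ ∘ ξ

  private
    instance
      N≢0 : ℕ.NonZero ℤ.∣ ξ Linℤ.· ξ ∣
      N≢0 = norm²-nonZero ξ nonzero

  κ : ℚ
  κ = (+ 2) ℚ./ ℤ.∣ ξ Linℤ.· ξ ∣

  open Reflection ℚ.+-*-commutativeRing ξℚ κ

  κ*norm² : κ ℚ.* (ξℚ Linℚ.· ξℚ) ≡ 1ℚ ℚ.+ 1ℚ
  κ*norm² = trans (cong (κ ℚ.*_) (trans (sym (fromℤ-· ξ ξ)) (cong fromℤ (sym (∣x·x∣≡x·x ξ)))))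
    (/-*-cancel (+ 2) ℤ.∣ ξ Linℤ.· ξ ∣)

  norm²≢0 : ξℚ Linℚ.· ξℚ ≢ 0ℚ
  norm²≢0 eq = nonzero λ i → fromℤ-injective (·-definite ξℚ eq i)

  Q₀≡reflection : ∀ i j → Q₀ w i j ≡ reflection i j
  Q₀≡reflection i j = cong (λ q → Linℚ.identityMatrix i j ℚ.- q)
    (trans (/-fromℤ (+ 2) (ξ i ℤ.* ξ j) ℤ.∣ ξ Linℤ.· ξ ∣)
           (cong (κ ℚ.*_) (fromℤ-* (ξ i) (ξ j))))

  ξ⊥walks : ∀ (j : Fin (suc k)) → ξℚ Linℚ.· walks F (toℕ j) ≡ 0ℚ
  ξ⊥walks j = begin
    ξℚ Linℚ.· walks F (toℕ j)
      ≡⟨ ℚ-Linear.·-comm ξℚ (walks F (toℕ j)) ⟩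
    walks F (toℕ j) Linℚ.· ξℚ
      ≡⟨ ℚ-Linear.·-cong {y = ξℚ} (λ i → fromℤ-walks F (toℕ j) i) (λ _ → refl) ⟨
    (λ i → fromℤ (walkMatrix F i j)) Linℚ.· ξℚ
      ≡⟨ fromℤ-· (λ i → walkMatrix F i j) ξ ⟨
    fromℤ ((λ i → walkMatrix F i j) Linℤ.· ξ)
      ≡⟨ cong fromℤ (kernel j) ⟩
    0ℚ ∎
    where open ≡.≡-Reasoning

  module _ (AC : AlmostControllable F) where

    orthogonal⇒parallel : ∀ d → (∀ (j : Fin k) → d Linℚ.· walks F (toℕ j) ≡ 0ℚ) →
                          ∀ i l → ξℚ i ℚ.* d l ≡ ξℚ l ℚ.* d i
    orthogonal⇒parallel d d⊥walks = ℚ-Dependence.corank-one ·-definite (λ j → walks F (toℕ j))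
      (walks-independent F AC) ξℚ d
      (λ j → subst (λ m → ξℚ Linℚ.· walks F m ≡ 0ℚ) (toℕ-inject₁ j) (ξ⊥walks (inject₁ j)))
      d⊥walks

    Q₀-automorphism : ((π , _) : IsPermutationMatrix (Q₀ w)) →
                      ∀ i j → adj F (π ⟨$⟩ʳ i) (π ⟨$⟩ʳ j) ≡ adj F i j
    Q₀-automorphism (π , Q₀≡π) i j = indicator-injective
      (reflection-automorphism (Linℚ.adjacencyMatrix F) (ℚ-Linear.adjacency-symmetric F)
        (orthogonal⇒parallel (Linℚ.adjacencyMatrix F Linℚ.*ᵥ ξℚ) λ j →
          -- Moving `A` across turns the inner product with column `j` of the walk matrix into that
          -- of `ξ` with column `j + 1`. For the largest `j` this is the last column, which
          -- `orthogonal⇒parallel` itself leaves out.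
          trans (ℚ-Linear.*ᵥ-selfAdjoint (ℚ-Linear.adjacency-symmetric F) ξℚ (walks F (toℕ j)))
                (ξ⊥walks (suc j)))
        π (λ i j → trans (sym (Q₀≡reflection i j)) (Q₀≡π i j)) i j)

    neighbourhood-dichotomy : ∀ b b′ →
      (∀ (j : Fin k) → b′ Linℚ.· walks F (toℕ j) ≡ b Linℚ.· walks F (toℕ j)) →
      b′ Linℚ.· b′ ≡ b Linℚ.· b → b′ ≗ b ⊎ b′ ≗ Q₀ w Linℚ.*ᵥ b
    neighbourhood-dichotomy b b′ walks≡ norms = [ inj₁ , inj₂ ∘ unreflected ]′ reflection-dichotomy
      where
      difference⊥walks : ∀ (j : Fin k) → (λ i → b′ i ℚ.- b i) Linℚ.· walks F (toℕ j) ≡ 0ℚ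
      difference⊥walks j = trans (ℚ-Linear.·-minusˡ b′ b (walks F (toℕ j)))
        (trans (cong (ℚ._- (b Linℚ.· walks F (toℕ j))) (walks≡ j))
               (ℚ.+-inverseʳ (b Linℚ.· walks F (toℕ j))))
      open Dichotomy (ℚ._≟ 0ℚ) ℚ-noZeroDivisors norm²≢0 κ*norm² b b′
        (orthogonal⇒parallel (λ i → b′ i ℚ.- b i) difference⊥walks) norms
      unreflected : b′ ≗ reflection Linℚ.*ᵥ b → b′ ≗ Q₀ w Linℚ.*ᵥ b
      unreflected eq i = trans (eq i) (ℚ-Linear.·-cong {x = reflection i} {Q₀ w i} {b} {b}
        (λ j → sym (Q₀≡reflection i j)) (λ _ → refl))

-- Reconstruction

≅-sym : ∀ {m n} {G : Graph m} {H : Graph n} → G ≅ H → H ≅ G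
≅-sym {H = H} (π , iso) = flip π , λ i j → sym (trans (iso (π ⟨$⟩ˡ i) (π ⟨$⟩ˡ j))
  (cong₂ (adj H) (inverseʳ π) (inverseʳ π)))

≅-trans : ∀ {l m n} {G : Graph l} {H : Graph m} {I : Graph n} → G ≅ H → H ≅ I → G ≅ I
≅-trans (π , iso) (ρ , iso′) = π ∘ₚ ρ , λ i j → trans (iso i j) (iso′ (π ⟨$⟩ʳ i) (π ⟨$⟩ʳ j))

pullback : ∀ {m n} → (Fin m → Fin n) → Graph n → Graph m
pullback f G = record
  { adj         = λ i j → adj G (f i) (f j)
  ; symmetric   = λ i j → symmetric G (f i) (f j)
  ; irreflexive = λ i → irreflexive G (f i)
  }

extend-automorphism : ∀ {k} {F : Graph k} {H G : Graph (suc k)} →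
  (∀ i j → adj H (suc i) (suc j) ≡ adj F i j) → (∀ i j → adj G (suc i) (suc j) ≡ adj F i j) →
  (σ : Permutation k k) → (∀ i j → adj F (σ ⟨$⟩ʳ i) (σ ⟨$⟩ʳ j) ≡ adj F i j) →
  (∀ i → adj H zero (suc i) ≡ adj G zero (suc (σ ⟨$⟩ʳ i))) → H ≅ G
extend-automorphism {F = F} {H} {G} blockH blockG σ automorphism border = lift₀ σ , iso
  where
  iso : ∀ i j → adj H i j ≡ adj G (lift₀ σ ⟨$⟩ʳ i) (lift₀ σ ⟨$⟩ʳ j)
  iso zero    zero    = trans (irreflexive H zero) (sym (irreflexive G zero))
  iso zero    (suc j) = border j
  iso (suc i) zero    = trans (symmetric H (suc i) zero) (trans (border i) (symmetric G zero _))
  iso (suc i) (suc j) = trans (blockH i j) (trans (sym (automorphism i j)) (sym (blockG _ _)))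

open WalkCounts ℚ.+-*-commutativeRing using (openWalk; closedWalk; pathWeight-map; permutation-*ᵥ; module Bordered)
open TupleSums ℚ.+-*-commutativeRing using (sumTuples)
open Kelly ℚ.+-*-commutativeRing 1/suc 1/suc-inverse using (Local; total; total-cong; total-reconstructible)

openLocal closedLocal : ∀ {m} → Local (suc m)
openLocal = openWalk , λ { F G f eq (x ∷ xs) →
  pathWeight-map f (λ i j → cong Linℚ.indicator (eq i j)) (λ _ → refl) x xs }
closedLocal = closedWalk , λ { F G f eq (x ∷ xs) →
  pathWeight-map f (λ i j → cong Linℚ.indicator (eq i j)) (λ i → cong Linℚ.indicator (eq i x)) x xs }

module _ {k} (F : Graph (suc k)) (H G : Graph (suc (suc k)))
  (blockH : ∀ i j → adj H (suc i) (suc j) ≡ adj F i j)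
  (blockG : ∀ i j → adj G (suc i) (suc j) ≡ adj F i j)
  (totals : ∀ {m} (h : Local m) → m ≤ suc k → total h H ≡ total h G) where

  private
    module HG = Comparison ℚ.+-*-commutativeRing ℚ-torsion-free F H G blockH blockG
    module BH = Bordered F H blockH
    module BG = Bordered F G blockG

    -- Here the card has `suc k` vertices, so the `s + 2` entries stay within the permitted `suc k`
    -- exactly for `s < k`.
    closed≡ : ∀ {s} → s ℕ.< k → sumTuples (2 ℕ.+ s) (closedWalk H) ≡ sumTuples (2 ℕ.+ s) (closedWalk G)
    closed≡ s<k = totals closedLocal (s≤s s<k)

    open≡ : ∀ {s} → s ℕ.< k → sumTuples (2 ℕ.+ s) (openWalk H) ≡ sumTuples (2 ℕ.+ s) (openWalk G)
    open≡ s<k = totals openLocal (s≤s s<k)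

  -- `returns 0` is the degree of the deleted vertex. It lies within the bound only when the graph
  -- has at least three vertices; indeed both graphs on two vertices have the same deck.
  border-norms : 0 ℕ.< k → BH.b Linℚ.· BH.b ≡ BG.b Linℚ.· BG.b
  border-norms = HG.returns≈ k closed≡ open≡ 0

  border-walks : ∀ {s} → s ℕ.< k → BH.b Linℚ.· walks F s ≡ BG.b Linℚ.· walks F s
  border-walks {s} s<k = trans
    (sym (ℚ-Linear.power-selfAdjoint (ℚ-Linear.adjacency-symmetric F) s BH.b Linℚ.ones))
    (trans (HG.departures≈ k closed≡ open≡ s s<k)
           (ℚ-Linear.power-selfAdjoint (ℚ-Linear.adjacency-symmetric F) s BG.b Linℚ.ones))

border : ∀ {k} → Graph (suc k) → Vector ℚ k
border G i = Linℚ.indicator (adj G zero (suc i))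

-- The hypotheses on `b′` are what the deck reveals about the border in a reconstruction. The
-- conclusion is weaker than `b′ = b`, since borders that differ by an automorphism of the card give
-- isomorphic graphs.
Forced : ∀ {k} → Graph k → Vector ℚ k → Set
Forced {k} F b = ∀ b′ → IsBinary b′ →
  (∀ {s} → s ℕ.< pred k → b′ Linℚ.· walks F s ≡ b Linℚ.· walks F s) → b′ Linℚ.· b′ ≡ b Linℚ.· b →
  Σ[ σ ∈ Permutation k k ]
    (∀ i j → adj F (σ ⟨$⟩ʳ i) (σ ⟨$⟩ʳ j) ≡ adj F i j) × (∀ i → b′ i ≡ b (σ ⟨$⟩ʳ i))

symmetric-forced : ∀ {k} (F : Graph (suc k)) b → Hˢ F → Forced F b
symmetric-forced {k} F b (AC , w , perm@(π , Q₀≡π)) b′ _ walks≡ norms =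
  [ unchanged , reflected ]′
    (neighbourhood-dichotomy w AC b b′ (λ j → walks≡ (Fin.toℕ<n j)) norms)
  where
  Extension : Set
  Extension = Σ[ σ ∈ Permutation (suc k) (suc k) ]
    (∀ i j → adj F (σ ⟨$⟩ʳ i) (σ ⟨$⟩ʳ j) ≡ adj F i j) × (∀ i → b′ i ≡ b (σ ⟨$⟩ʳ i))
  unchanged : b′ ≗ b → Extension
  unchanged b′≗b = idₚ , (λ _ _ → refl) , b′≗b
  reflected : b′ ≗ Q₀ w Linℚ.*ᵥ b → Extension
  reflected b′≗Q₀b = π , Q₀-automorphism w AC perm , λ i →
    trans (b′≗Q₀b i) (permutation-*ᵥ {Q = Q₀ w} π Q₀≡π b i)

-- If `b′` is the reflection of `b`, then the reflection is binary because `b′` is, so it cannot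
-- differ from `b`. Decidable equality of rational vectors turns this into an equation.
asymmetric-forced : ∀ {k} (F : Graph (suc k)) b → AlmostControllable F → (w : WalkNormal F) →
  ¬ (IsBinary (Q₀ w Linℚ.*ᵥ b) × ¬ (Q₀ w Linℚ.*ᵥ b ≗ b)) → Forced F b
asymmetric-forced F b AC w notNewBinary b′ binary walks≡ norms =
  idₚ , (λ _ _ → refl) , [ (λ b′≗b → b′≗b) , reflected ]′
    (neighbourhood-dichotomy w AC b b′ (λ j → walks≡ (Fin.toℕ<n j)) norms)
  where
  reflected : b′ ≗ Q₀ w Linℚ.*ᵥ b → b′ ≗ b
  reflected b′≗Q₀b i = trans (b′≗Q₀b i)
    (decidable-stable (all? λ i → (Q₀ w Linℚ.*ᵥ b) i ℚ.≟ b i)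
      (λ Q₀b≢b → notNewBinary ((λ i → subst (λ q → q ≡ 0ℚ ⊎ q ≡ 1ℚ) (b′≗Q₀b i) (binary i)) , Q₀b≢b)) i)

border-binary : ∀ {k} (G : Graph (suc k)) → IsBinary (border G)
border-binary G i with adj G zero (suc i)
... | true  = inj₂ refl
... | false = inj₁ refl

forced⇒≅ : ∀ {k} (G : Graph (suc (suc k))) u → 0 ℕ.< k →
  Forced (G ∖ u) (neighbourhood G u) → (H : Graph (suc (suc k))) → IsReconstruction H G → H ≅ G
forced⇒≅ {k} G u 0<k forced H rec@(φ , cards) =
  ≅-trans {G = H} {H*} {G} (≅-sym {G = H*} {H} H*≅H) (≅-trans {G = H*} {G*} {G} H*≅G* G*≅G)
  where
  F : Graph (suc k)
  F = G ∖ u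
  v : Fin (suc (suc k))
  v = φ ⟨$⟩ˡ u
  card : H ∖ v ≅ F
  card = subst (λ z → H ∖ v ≅ G ∖ z) (inverseʳ φ) (cards v)
  π : Permutation (suc k) (suc k)
  π = proj₁ card
  -- Both relabellings move the deleted vertex to `zero`. That of `G` keeps the order of the other
  -- vertices, so its block is `F` by computation; that of `H` also aligns its card with `F` through
  -- the inverse of `π`.
  G* H* : Graph (suc (suc k))
  G* = pullback (insert zero u idₚ ⟨$⟩ʳ_) G
  H* = pullback (insert zero v (flip π) ⟨$⟩ʳ_) H
  G*≅G : G* ≅ G
  G*≅G = insert zero u idₚ , λ _ _ → refl
  H*≅H : H* ≅ H
  H*≅H = insert zero v (flip π) , λ _ _ → refl
  blockG : ∀ i j → adj G* (suc i) (suc j) ≡ adj F i j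
  blockG i j = refl
  blockH : ∀ i j → adj H* (suc i) (suc j) ≡ adj F i j
  blockH i j = trans (proj₂ card (π ⟨$⟩ˡ i) (π ⟨$⟩ˡ j)) (cong₂ (adj F) (inverseʳ π) (inverseʳ π))
  totals : ∀ {m} (h : Local m) → m ≤ suc k → total h H* ≡ total h G*
  totals h m≤ = trans (total-cong h {F = H*} {H} H*≅H)
    (trans (total-reconstructible h H G (s≤s m≤) rec) (sym (total-cong h {F = G*} {G} G*≅G)))
  σ = forced (border H*) (border-binary H*)
    (border-walks F H* G* blockH blockG totals) (border-norms F H* G* blockH blockG totals 0<k)
  H*≅G* : H* ≅ G*
  H*≅G* = extend-automorphism {F = F} {H*} {G*} blockH blockG (proj₁ σ) (proj₁ (proj₂ σ))
    (λ i → indicator-injective (proj₂ (proj₂ σ) i))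

forced⇒reconstructible : ∀ {k} (G : Graph (suc (suc k))) u → 0 ℕ.< k →
  Forced (G ∖ u) (neighbourhood G u) → Reconstructible G
forced⇒reconstructible {k} G u 0<k forced H rec = sameSize (↔⇒≡ (proj₁ rec)) H rec
  where
  sameSize : ∀ {m} → m ≡ suc (suc k) → (H : Graph m) → IsReconstruction H G → H ≅ G
  sameSize refl = forced⇒≅ G u 0<k forced

theorem6 : ∀ {n : ℕ} → 3 ≤ n → (G : Graph n) →
    (∃[ u ] (Hˢ (G ∖ u) ⊎
             (Hᵃ (G ∖ u) × (Σ[ w ∈ WalkNormal (G ∖ u) ]
               (let b = neighbourhood G u
                    Q₀b = Q₀ w Linℚ.*ᵥ b
                in ¬ (IsBinary Q₀b × ¬ (Q₀b ≗ b))))))) →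
    Reconstructible G
theorem6 (s≤s (s≤s (s≤s _))) G (u , condition) =
  forced⇒reconstructible G u (s≤s ℕ.z≤n)
    ([ symmetric-forced (G ∖ u) (neighbourhood G u)
     , (λ ((AC , _) , w , notNewBinary) →
          asymmetric-forced (G ∖ u) (neighbourhood G u) AC w notNewBinary)
     ]′ condition)
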